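{- The prefixes $123$ and $321$ may be exchanged. That is, for every $k\ge 3$, every ordering $\tau=\tau_4\ldots\tau_k$ of $\{4,\dots,k\}$, and every $n$, $\mathcal{I}_n(123\tau_4\ldots\tau_k)=\mathcal{I}_n(321\tau_4\ldots\tau_k)$.
   Context: A permutation $\pi=\pi_1\ldots\pi_n\in\mathcal{S}_n$ avoids $\sigma\in\mathcal{S}_k$ if there is no subsequence $\pi_{i_1}\ldots\pi_{i_k}$, $i_1<\cdots<i_k$, whose order-preserving relabelling by $1,\dots,k$ is $\sigma$. $\mathcal{I}_n(\sigma)$ denotes the number of involutions in $\mathcal{S}_n$ (permutations whose square is the identity) which avoid $\sigma$. Write $\sigma\sim_{\mathcal I}\sigma'$ if $\mathcal{I}_n(\sigma)=\mathcal{I}_n(\sigma')$ for every $n$. For $\alpha,\beta\in\mathcal{S}_j$, the prefixes $\alpha$ and $\beta$ may be exchanged if for every $k\ge j$ and every ordering $\tau=\tau_{j+1}\ldots\tau_k$ of $\{j+1,\dots,k\}$, $\alpha_1\ldots\alpha_j\tau_{j+1}\ldots\tau_k\sim_{\mathcal I}\beta_1\ldots\beta_j\tau_{j+1}\ldots\tau_k$. -}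

-- Letters and positions are counted from 0: the permutation 321 of 𝒮₃ is
-- 2F ∷ 1F ∷ 0F ∷ [].

module Defs where

open import Data.Fin using (Fin; _<_; _↑ˡ_; _↑ʳ_)
open import Data.Fin.Properties using (_≟_; _<?_; all?; any?)
open import Data.List as List using (List; allFin; cartesianProductWith; filter; length)
open import Data.List.Membership.Propositional using (_∈_; find; lose)
open import Data.List.Membership.Propositional.Properties using (∈-allFin; ∈-cartesianProductWith⁺)
open import Data.List.Relation.Unary.All using ([])
open import Data.List.Relation.Unary.AllPairs using ([]; _∷_)
open import Data.List.Relation.Unary.Any as Any using (here)
open import Data.List.Relation.Unary.Unique.Propositional using (Unique)
open import Data.List.Relation.Unary.Unique.Propositional.Properties using (allFin⁺; cartesianProductWith⁺)
open import Data.Nat using (ℕ; zero; suc; _+_)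
open import Data.Product using (∃; _×_; _,_)
open import Data.Vec using (Vec; []; _∷_; _++_; lookup; map)
open import Data.Vec.Properties using (∷-injective)
open import Function using (_∘_; _⇔_; mk⇔; Equivalence)
open import Function.Consequences.Propositional using (strictlySurjective⇒surjective; surjective⇒strictlySurjective)
open import Function.Definitions using (Bijective)
open import Relation.Binary.Definitions using (Monotonic₁)
open import Relation.Binary.PropositionalEquality using (_≡_; refl)
open import Relation.Nullary using (Dec; ¬_)
open import Relation.Nullary.Decidable using (map′; _×-dec_; _→-dec_; ¬?)
open import Relation.Unary using (Decidable)

private
  variable
    j k n : ℕ

words : ∀ n k → List (Vec (Fin n) k)
words n zero    = List.[ [] ]
words n (suc k) = cartesianProductWith _∷_ (allFin n) (words n k)

words-complete : (w : Vec (Fin n) k) → w ∈ words n k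
words-complete []      = here refl
words-complete (x ∷ w) = ∈-cartesianProductWith⁺ _∷_ (∈-allFin x) (words-complete w)

words-unique : ∀ n k → Unique (words n k)
words-unique n zero    = [] ∷ []
words-unique n (suc k) = cartesianProductWith⁺ _∷_ ∷-injective (allFin⁺ n) (words-unique n k)

-- One-line notation: π₁…πₙ is the vector whose i-th entry is πᵢ.
IsPermutation : Vec (Fin n) n → Set
IsPermutation π = Bijective _≡_ _≡_ (lookup π)

IsInvolution : Vec (Fin n) n → Set
IsInvolution π = IsPermutation π × (∀ i → lookup π (lookup π i) ≡ i)

-- The entries of ι are the positions i₁ < … < iₖ of a subsequence of π.  That
-- its order-preserving relabelling is σ means that its letters compare with
-- each other as those of σ do.
IsOccurrence : Vec (Fin n) n → Vec (Fin k) k → Vec (Fin n) k → Set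
IsOccurrence π σ ι =
  Monotonic₁ _<_ _<_ (lookup ι) ×
  (∀ a b → lookup π (lookup ι a) < lookup π (lookup ι b) ⇔ lookup σ a < lookup σ b)

Contains : Vec (Fin n) n → Vec (Fin k) k → Set
Contains π σ = ∃ (IsOccurrence π σ)

Avoids : Vec (Fin n) n → Vec (Fin k) k → Set
Avoids π σ = ¬ Contains π σ

isPermutation? : Decidable (IsPermutation {n})
isPermutation? π =
  map′ (λ f {x} {y} → f x y) (λ f x y → f)
    (all? λ x → all? λ y → (lookup π x ≟ lookup π y) →-dec (x ≟ y))
  ×-dec
  map′ strictlySurjective⇒surjective surjective⇒strictlySurjective
    (all? λ y → any? λ x → lookup π x ≟ y)

isInvolution? : Decidable (IsInvolution {n})
isInvolution? π = isPermutation? π ×-dec all? (λ i → lookup π (lookup π i) ≟ i)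

isOccurrence? : (π : Vec (Fin n) n) (σ : Vec (Fin k) k) → Decidable (IsOccurrence π σ)
isOccurrence? π σ ι =
  map′ (λ f {x} {y} → f x y) (λ f x y → f)
    (all? λ a → all? λ b → (a <? b) →-dec (lookup ι a <? lookup ι b))
  ×-dec
  all? λ a → all? λ b →
    iff? (lookup π (lookup ι a) <? lookup π (lookup ι b)) (lookup σ a <? lookup σ b)
  where
  iff? : {P Q : Set} → Dec P → Dec Q → Dec (P ⇔ Q)
  iff? p? q? = map′ (λ (f , g) → mk⇔ f g) (λ e → Equivalence.to e , Equivalence.from e)
    ((p? →-dec q?) ×-dec (q? →-dec p?))

contains? : (π : Vec (Fin n) n) (σ : Vec (Fin k) k) → Dec (Contains π σ)
contains? π σ =
  map′ (λ p → let ι , _ , o = find p in ι , o) (λ (ι , o) → lose (words-complete ι) o)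
    (Any.any? (isOccurrence? π σ) (words _ _))

avoids? : (π : Vec (Fin n) n) (σ : Vec (Fin k) k) → Dec (Avoids π σ)
avoids? π σ = ¬? (contains? π σ)

𝓘 : ∀ n → Vec (Fin k) k → ℕ
𝓘 n σ = length (filter (λ π → isInvolution? π ×-dec avoids? π σ) (words n n))

infix 4 _∼_

_∼_ : Vec (Fin j) j → Vec (Fin k) k → Set
σ ∼ σ′ = ∀ n → 𝓘 n σ ≡ 𝓘 n σ′

infixr 5 _⊕_

-- The word α₁…αⱼτⱼ₊₁…τₖ, where k = j + m and the ordering τⱼ₊₁…τₖ of
-- {j+1,…,k} is given by the permutation of 𝒮ₘ obtained by lowering each of its
-- letters by j.
_⊕_ : ∀ {j m} → Vec (Fin j) j → Vec (Fin m) m → Vec (Fin (j + m)) (j + m)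
_⊕_ {j} {m} α τ = map (_↑ˡ m) α ++ map (j ↑ʳ_) τ

-- Meant for permutations α and β.
PrefixesExchangeable : Vec (Fin j) j → Vec (Fin j) j → Set
PrefixesExchangeable α β = ∀ m (τ : Vec (Fin m) m) → IsPermutation τ → α ⊕ τ ∼ β ⊕ τ

{-# OPTIONS --safe #-}

-- In an involution π, the cells having an occurrence of τ strictly to the north-
-- east of them or of their mirror image form a symmetric Ferrers board, and π
-- contains 123τ (321τ) exactly when it has a 123 (321) all of whose bounding
-- rectangle lies on the board.  Keep the points outside the board.  The filling of
-- the board is encoded by its Fomin growth diagram: the filling avoids 123 (321)
-- exactly when the Robinson–Schensted shapes at the corners of the board have at
-- most two columns (rows), and it can be recovered from the shapes along the
-- border (Krattenthaler).  Transposing the shapes along the border thus exchanges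
-- the avoiders of 123 and of 321.  Symmetric fillings have symmetric diagrams, so
-- involutions go to involutions, and the occurrences of τ that define the board
-- can be taken outside it, so the board does not change.
module Submission where

open import Defs
open import Data.Bool using (Bool; true; false; if_then_else_)
open import Data.Bool.Properties using (⇔→≡)
open import Data.Empty using (⊥; ⊥-elim)
open import Data.Fin as Fin using (Fin; toℕ; _↑ˡ_; _↑ʳ_)
open import Data.Fin.Patterns using (0F; 1F; 2F)
open import Data.Fin.Properties as Fin using (toℕ-↑ˡ; toℕ-↑ʳ; toℕ<n; join-splitAt; toℕ-injective; toℕ-fromℕ<; injective⇒≤)
open import Data.List as List using (List; length; filter)
open import Data.List.Membership.Propositional using (_∈_; find; lose)
open import Data.List.Membership.Propositional.Properties using (∈-lookup; ∈-filter⁺; ∈-filter⁻)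
open import Data.List.Relation.Unary.All as All using ()
open import Data.List.Relation.Unary.AllPairs using (_∷_)
open import Data.List.Relation.Unary.Any as Any using ()
open import Data.List.Relation.Unary.Any.Properties using (lookup-index)
open import Data.List.Relation.Unary.Unique.Propositional using (Unique)
open import Data.List.Relation.Unary.Unique.Propositional.Properties using (filter⁺)
open import Data.Nat using (ℕ; zero; suc; _+_; _∸_; _≤_; _<_; z≤n; s≤s)
open import Data.Nat.Properties
open import Data.Product using (∃; ∃₂; _×_; _,_; proj₁; proj₂; -,_)
open import Data.Sum as Sum using (_⊎_; inj₁; inj₂; swap)
open import Data.Vec using (Vec; []; _∷_; _++_; lookup; map; splitAt; tabulate)
open import Data.Vec.Properties using (lookup-++ˡ; lookup-++ʳ; lookup-map; lookup∘tabulate; tabulate∘lookup; tabulate-cong)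
open import Function using (flip; id; _∘_; _⇔_; mk⇔; Equivalence)
open import Function.Consequences.Propositional using (strictlySurjective⇒surjective)
open import Relation.Binary using (tri<; tri≈; tri>)
open import Relation.Binary.PropositionalEquality
open import Relation.Nullary using (Dec; yes; no; ¬_; does)
open import Relation.Nullary.Decidable using (dec-true; dec-false; map′; from-yes; _×-dec_; _⊎-dec_; _→-dec_)
open import Relation.Unary using (Decidable)

-- Shapes, edges and local rules

-- A partition with at most two parts, as (difference of the parts , smaller part).
-- The parts are the column lengths for 123 and the row lengths for 321, so that
-- transposition is the identity on Shape.
Shape : Set
Shape = ℕ × ℕ

pattern ∅ = 0 , 0

-- Whether nothing, a box in the longer part or a box in the shorter part is added.
data Kind : Set where
  idle first second : Kind

data Edge : Kind → Shape → Shape → Set where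
  idle   : ∀ {p} → Edge idle p p
  first  : ∀ {d s} → Edge first (d , s) (suc d , s)
  second : ∀ {d s} → Edge second (suc d , s) (d , suc s)

data Pattern : Set where
  inc dec : Pattern

private
  variable
    X Y : Pattern
    p p′ q r t t′ : Shape
    k k′ l l′ : Kind
    b b′ : Bool

-- Fomin's local rules for Robinson–Schensted with row insertion, for partitions
-- with at most two columns (inc) or rows (dec).  The arguments are the shape
-- at the south-west corner of a cell, the kinds of its bottom and left edges,
-- whether it holds a point, and the kinds of its top and right edges.
data Rule : Pattern → Shape → Kind → Kind → Bool → Kind → Kind → Set where
  horizontal : Rule X p k idle false k idle
  vertical   : Rule X p idle l false idle l
  cross₁₂    : Rule X p first second false first second
  cross₂₁    : Rule X p second first false second first
  inc-point₁ : Rule inc ∅ idle idle true first first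
  inc-point₂ : ∀ {d} → Rule inc (suc d , 0) idle idle true second second
  inc-first  : Rule inc p first first false first first
  inc-second : ∀ {d s} → Rule inc (suc (suc d) , s) second second false second second
  inc-turn   : ∀ {s} → Rule inc (1 , s) second second false first first
  dec-point  : Rule dec p idle idle true first first
  dec-turn   : Rule dec p first first false second second

record Square (X : Pattern) (p q r t : Shape) (b : Bool) : Set where
  constructor square
  field
    {bottomKind leftKind topKind rightKind} : Kind
    bottom : Edge bottomKind p q
    left   : Edge leftKind p r
    top    : Edge topKind r t
    right  : Edge rightKind q t
    rule   : Rule X p bottomKind leftKind b topKind rightKind

rule-flip : Rule X p k l b k′ l′ → Rule X p l k b l′ k′
rule-flip horizontal = vertical
rule-flip vertical   = horizontal
rule-flip cross₁₂    = cross₂₁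
rule-flip cross₂₁    = cross₁₂
rule-flip inc-point₁ = inc-point₁
rule-flip inc-point₂ = inc-point₂
rule-flip inc-first  = inc-first
rule-flip inc-second = inc-second
rule-flip inc-turn   = inc-turn
rule-flip dec-point  = dec-point
rule-flip dec-turn   = dec-turn

square-flip : Square X p q r t b → Square X p r q t b
square-flip (square e f g h ρ) = square f e h g (rule-flip ρ)

-- An edge changes the difference of the parts by 0, 1 or -1, so the differences alone tell its
-- kind.
kind : Shape → Shape → Kind
kind (zero  , _) (zero  , _) = idle
kind (zero  , _) (suc _ , _) = first
kind (suc _ , _) (zero  , _) = second
kind (suc d , s) (suc e , u) = kind (d , s) (e , u)

kind-edge : Edge k p q → kind p q ≡ k
kind-edge {p = zero  , _} idle           = refl
kind-edge {p = suc d , s} idle           = kind-edge {p = d , s} idle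
kind-edge {p = zero  , _} first          = refl
kind-edge {p = suc d , s} first          = kind-edge {p = d , s} first
kind-edge {p = suc zero , _} second      = refl
kind-edge {p = suc (suc d) , s} second   = kind-edge {p = suc d , s} second

edge-unique : Edge k p q → Edge k′ p q → k ≡ k′
edge-unique e f = trans (sym (kind-edge e)) (kind-edge f)

edge? : Edge k p q → Dec (k ≡ idle)
edge? idle = yes refl
edge? first = no λ ()
edge? second = no λ ()

idle-≡ : Edge idle p q → p ≡ q
idle-≡ idle = refl

≡-idle : Edge k p q → p ≡ q → k ≡ idle
≡-idle e refl = edge-unique e idle

target : Kind → Shape → Shape
target first  (d , s)     = suc d , s
target second (suc d , s) = d , suc s
target _      p           = p

target-edge : Edge k p q → target k p ≡ q
target-edge idle   = refl
target-edge first  = refl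
target-edge second = refl

source : Kind → Shape → Shape
source first  (suc d , s) = d , s
source second (d , suc s) = suc d , s
source _      p           = p

source-edge : Edge k p q → source k q ≡ p
source-edge idle   = refl
source-edge first  = refl
source-edge second = refl

-- The values of pointTop, turnTop, firstsBottom and secondsBottom where no rule
-- applies are junk.
pointTop : Pattern → Shape → Kind
pointTop inc (zero  , _) = first
pointTop inc (suc _ , _) = second
pointTop dec _           = first

turnTop : Shape → Kind
turnTop (suc (suc _) , _) = second
turnTop _                 = first

topOf : Pattern → Shape → Kind → Kind → Bool → Kind
topOf X   p idle   idle   false = idle
topOf X   p idle   idle   true  = pointTop X p
topOf X   p idle   first  b     = idle
topOf X   p idle   second b     = idle
topOf X   p first  idle   b     = first
topOf inc p first  first  b     = first
topOf dec p first  first  b     = second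
topOf X   p first  second b     = first
topOf X   p second idle   b     = second
topOf X   p second first  b     = second
topOf X   p second second b     = turnTop p

topOf-rule : Rule X p k l b k′ l′ → topOf X p k l b ≡ k′
topOf-rule {k = idle}   horizontal = refl
topOf-rule {k = first}  horizontal = refl
topOf-rule {k = second} horizontal = refl
topOf-rule {l = idle}   vertical   = refl
topOf-rule {l = first}  vertical   = refl
topOf-rule {l = second} vertical   = refl
topOf-rule cross₁₂    = refl
topOf-rule cross₂₁    = refl
topOf-rule inc-point₁ = refl
topOf-rule inc-point₂ = refl
topOf-rule inc-first  = refl
topOf-rule inc-second = refl
topOf-rule inc-turn   = refl
topOf-rule dec-point  = refl
topOf-rule dec-turn   = refl

ahead : Pattern → Shape → Shape → Shape → Bool → Shape
ahead X p q r b = target (topOf X p (kind p q) (kind p r) b) r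

ahead-square : Square X p q r t b → ahead X p q r b ≡ t
ahead-square (square e f g h ρ)
  rewrite kind-edge e | kind-edge f | topOf-rule ρ = target-edge g

firstsBottom : Pattern → Shape → Kind × Bool
firstsBottom inc (suc (suc _) , _) = first  , false
firstsBottom inc (_ , zero)        = idle   , true
firstsBottom inc (_ , suc _)       = second , false
firstsBottom dec _                 = idle   , true

secondsBottom : Pattern → Shape → Kind × Bool
secondsBottom inc (_ , suc (suc _)) = second , false
secondsBottom inc _                 = idle   , true
secondsBottom dec _                 = first  , false

bottomOf : Pattern → Shape → Kind → Kind → Kind × Bool
bottomOf X t idle   l      = idle , false
bottomOf X t first  idle   = first , false
bottomOf X t first  first  = firstsBottom X t
bottomOf X t first  second = first , false
bottomOf X t second idle   = second , false
bottomOf X t second first  = second , false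
bottomOf X t second second = secondsBottom X t

behind : Pattern → Shape → Shape → Shape → Shape × Bool
behind X q r t = let k , b = bottomOf X t (kind r t) (kind q t) in source k q , b

-- Rules with the same top and right kinds are told apart by `t`. For `inc`, two first edges into
-- `(1 , 0)` come from a point, into `(1 , suc s)` from `inc-turn`, and into a larger difference
-- from `inc-first`; two second edges come from a point exactly when the shorter part of `t` is 1.
bottomOf-rule : Edge k p q → Edge k′ r t → Edge l′ q t →
                Rule X p k l b k′ l′ → bottomOf X t k′ l′ ≡ (k , b)
bottomOf-rule {k′ = idle}   e f g horizontal = refl
bottomOf-rule {k′ = first}  e f g horizontal = refl
bottomOf-rule {k′ = second} e f g horizontal = refl
bottomOf-rule               e f g vertical   = refl
bottomOf-rule               e f g cross₁₂    = refl
bottomOf-rule               e f g cross₂₁    = refl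
bottomOf-rule idle   f first  inc-point₁     = refl
bottomOf-rule idle   f second inc-point₂     = refl
bottomOf-rule first  f first  inc-first      = refl
bottomOf-rule second f second inc-second     = refl
bottomOf-rule second f first  inc-turn       = refl
bottomOf-rule idle   f first  dec-point      = refl
bottomOf-rule first  f second dec-turn       = refl

behind-square : Square X p q r t b → behind X q r t ≡ (p , b)
behind-square (square e f g h ρ)
  rewrite kind-edge g | kind-edge h | bottomOf-rule e g h ρ | source-edge e = refl

-- Backwards nothing is blocked. Forwards, two second edges (`dec`) or a point over a shape with two
-- columns (`inc`) would lead out of the partitions with two parts.
square-exists : Edge k′ r t → Edge l′ q t → ∃₂ λ p b → Square X p q r t b
square-exists idle f = -, -, square idle f idle f vertical
square-exists f@first  idle = -, -, square f idle f idle horizontal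
square-exists f@second idle = -, -, square f idle f idle horizontal
square-exists {X = inc} first (first {zero} {zero}) = -, -, square idle idle first first inc-point₁
square-exists {X = inc} first (first {zero} {suc s}) = -, -, square second second first first inc-turn
square-exists {X = inc} first (first {suc d}) = -, -, square first first first first inc-first
square-exists {X = inc} second (second {d} {zero}) = -, -, square idle idle second second inc-point₂
square-exists {X = inc} second (second {d} {suc s}) = -, -, square second second second second inc-second
square-exists {X = dec} first first = -, -, square idle idle first first dec-point
square-exists {X = dec} second second = -, -, square first first second second dec-turn
square-exists first second = -, -, square first second first second cross₁₂
square-exists second first = -, -, square second first second first cross₂₁

behind-exists : Edge k′ r t → Edge l′ q t →
                 let p , b = behind X q r t in Square X p q r t b
behind-exists {X = X} e f with p , b , S ← square-exists {X = X} e f =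
  subst (λ (p , b) → Square X p _ _ _ b) (sym (behind-square S)) S

-- Together with `idle-bottom` this is the source of the principle that an edge across a column is
-- live exactly when the column has a point below it.
idle-top : Square X p q r t b → r ≡ t → p ≡ q × b ≡ false
idle-top (square e    f idle h horizontal) _ = idle-≡ e , refl
idle-top (square idle f idle h vertical)   _ = refl , refl

idle-bottom : Square X p q r t false → p ≡ q → r ≡ t
idle-bottom (square idle f g h horizontal) _ = idle-≡ g
idle-bottom (square idle f g h vertical)   _ = idle-≡ g

point-bottom : Square X p q r t true → p ≡ q
point-bottom (square idle _ _ _ inc-point₁) = refl
point-bottom (square idle _ _ _ inc-point₂) = refl
point-bottom (square idle _ _ _ dec-point)  = refl

edge-nonempty : Edge k p q → p ≢ ∅ → q ≢ ∅
edge-nonempty idle   p≢∅ = p≢∅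
edge-nonempty first  _   = λ ()
edge-nonempty second _   = λ ()

edge-short : Edge k p q → 0 < proj₂ p → 0 < proj₂ q
edge-short idle   0<s = 0<s
edge-short first  0<s = 0<s
edge-short second _   = s≤s z≤n

inc-point-nonempty : Square inc p q r t true → t ≢ ∅
inc-point-nonempty (square idle idle first  _ inc-point₁) ()
inc-point-nonempty (square idle idle second _ inc-point₂) ()

inc-point-short : Square inc p q r t true → p ≢ ∅ → 0 < proj₂ t
inc-point-short (square idle idle _ _      inc-point₁) p≢∅ = ⊥-elim (p≢∅ refl)
inc-point-short (square idle idle _ second inc-point₂) _   = s≤s z≤n

inc-point-¬short : Square inc p q r t true → ¬ 0 < proj₂ p
inc-point-¬short (square _ _ _ _ inc-point₁) ()
inc-point-¬short (square _ _ _ _ inc-point₂) ()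

-- Only a point over a nonempty shape creates a second column; all other rules leading to two
-- columns find them at `q` or `r` already.
inc-short : Square inc p q r t b → 0 < proj₂ t →
            0 < proj₂ q ⊎ 0 < proj₂ r ⊎ (b ≡ true × p ≢ ∅)
inc-short (square _ _ _ idle horizontal)         0<s = inj₁ 0<s
inc-short (square _ _ idle _ vertical)           0<s = inj₂ (inj₁ 0<s)
inc-short (square _ second _ _ cross₁₂)          _   = inj₂ (inj₁ (s≤s z≤n))
inc-short (square second _ _ _ cross₂₁)          _   = inj₁ (s≤s z≤n)
inc-short (square idle idle first _ inc-point₁)  ()
inc-short (square _ _ _ _ inc-point₂)            _   = inj₂ (inj₂ (refl , λ ()))
inc-short (square _ _ first _ inc-first)         0<s = inj₂ (inj₁ 0<s)
inc-short (square second _ _ _ inc-second)       _   = inj₁ (s≤s z≤n)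
inc-short (square second _ _ _ inc-turn)         _   = inj₁ (s≤s z≤n)

dec-second : Square dec p q r t b → Edge second r t →
             Edge second p q ⊎ (Edge first p q × Edge first p r)
dec-second (square e f g h ρ) second with edge-unique g second | ρ
... | refl | horizontal = inj₁ e
... | refl | cross₂₁    = inj₁ e
... | refl | dec-turn   = inj₂ (e , f)

dec-second-persists : Square dec p q r t b → Edge second p q → Edge second r t
dec-second-persists (square e f g h ρ) second with edge-unique e second | ρ
... | refl | horizontal = g
... | refl | cross₂₁    = g

dec-cross : Square dec p q r t b → p ≢ q → p ≢ r → Edge second r t ⊎ Edge second q t
dec-cross (square e f g h horizontal) p≢q p≢r = ⊥-elim (p≢r (idle-≡ f))
dec-cross (square e f g h vertical)   p≢q p≢r = ⊥-elim (p≢q (idle-≡ e))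
dec-cross (square e f g h cross₁₂)    p≢q p≢r = inj₂ h
dec-cross (square e f g h cross₂₁)    p≢q p≢r = inj₁ g
dec-cross (square e f g h dec-point)  p≢q p≢r = ⊥-elim (p≢q (idle-≡ e))
dec-cross (square e f g h dec-turn)   p≢q p≢r = inj₁ g

dec-¬second² : Square dec p q r t b → Edge second p q → ¬ Edge second p r
dec-¬second² (square e f g h ρ) e′ f′ with edge-unique e e′ | edge-unique f f′ | ρ
... | refl | refl | ()

-- Growth diagrams

DownClosed : (ℕ → ℕ → Set) → Set
DownClosed V = ∀ {i i′ j j′} → i′ ≤ i → j′ ≤ j → V i j → V i′ j′

Rectangle : (ℕ → ℕ → Set) → ℕ → ℕ → Set
Rectangle V i j = ∀ {x y} → x < i → y < j → V x y

-- V is the set of cells, a cell being named by its south-west corner; M is the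
-- filling of the cells, and L labels their corners.
record Growth (X : Pattern) (V : ℕ → ℕ → Set) (M : ℕ → ℕ → Bool)
              (L : ℕ → ℕ → Shape) : Set where
  field
    west   : ∀ j → L 0 j ≡ ∅
    south  : ∀ i → L i 0 ≡ ∅
    cell   : ∀ {i j} → V i j →
             Square X (L i j) (L (suc i) j) (L i (suc j)) (L (suc i) (suc j)) (M i j)

open Growth

private
  variable
    V V′ : ℕ → ℕ → Set
    M M′ : ℕ → ℕ → Bool
    L L′ : ℕ → ℕ → Shape
    i i′ j j′ m n x y h : ℕ

growth-flip : Growth X V M L → Growth X (flip V) (flip M) (flip L)
growth-flip G .west    = G .south
growth-flip G .south   = G .west
growth-flip G .cell v  = square-flip (G .cell v)

growth-resp : (∀ {i j} → V′ i j → V i j) → (∀ {i j} → V′ i j → M i j ≡ M′ i j) →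
              Growth X V M L → Growth X V′ M′ L
growth-resp V′⊆V M≡M′ G .west  = G .west
growth-resp V′⊆V M≡M′ G .south = G .south
growth-resp V′⊆V M≡M′ G .cell v = subst (Square _ _ _ _ _) (M≡M′ v) (G .cell (V′⊆V v))

rectangle-≤ : i′ ≤ i → j′ ≤ j → Rectangle V i j → Rectangle V i′ j′
rectangle-≤ i′≤i j′≤j R x<i′ y<j′ = R (≤-trans x<i′ i′≤i) (≤-trans y<j′ j′≤j)

rectangle-flip : Rectangle V i j → Rectangle (flip V) j i
rectangle-flip R y<j x<i = R x<i y<j

module _ (G : Growth X V M L) where

  column-edge : Rectangle V (suc i) h → ∃ λ k → Edge k (L i h) (L (suc i) h)
  column-edge {i} {zero}  R rewrite G .south i | G .south (suc i) = -, idle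
  column-edge {i} {suc h} R = -, Square.top (G .cell (R ≤-refl ≤-refl))

  column-live : Rectangle V (suc i) h → y < h → M i y ≡ true → L i h ≢ L (suc i) h
  column-live {i} {suc h} {y} R y<h My eq
    with p≡q , Mh ← idle-top (G .cell (R ≤-refl ≤-refl)) eq
    with m<1+n⇒m<n∨m≡n y<h
  ... | inj₁ y<h′ = column-live (rectangle-≤ ≤-refl (n≤1+n h) R) y<h′ My p≡q
  ... | inj₂ refl with () ← trans (sym My) Mh

  column-point : Rectangle V (suc i) h → L i h ≢ L (suc i) h → ∃ λ y → y < h × M i y ≡ true
  column-point {i} {zero} R live = ⊥-elim (live (trans (G .south i) (sym (G .south (suc i)))))
  column-point {i} {suc h} R live with M i h in eq
  ... | true = h , ≤-refl , eq
  ... | false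
    with y , y<h , My ← column-point (rectangle-≤ ≤-refl (n≤1+n h) R)
           (live ∘ idle-bottom (subst (Square _ _ _ _ _) eq (G .cell (R ≤-refl ≤-refl))))
    = y , m<n⇒m<1+n y<h , My

module _ {P : Shape → Set} (P-edge : ∀ {k p q} → Edge k p q → P p → P q) where

  monotone-column : Growth X V M L → i ≤ i′ → Rectangle V i′ j → P (L i j) → P (L i′ j)
  monotone-column {i = i} {i′ = i′} {j = j} G i≤i′ R Pij with m≤n⇒m<n∨m≡n i≤i′
  ... | inj₂ refl = Pij
  monotone-column {i = i} {i′ = suc i′} {j = j} G i≤i′ R Pij | inj₁ (s≤s i≤)
    = P-edge (proj₂ (column-edge G R)) (monotone-column G i≤ (rectangle-≤ (n≤1+n i′) ≤-refl R) Pij)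

  monotone : Growth X V M L → i ≤ i′ → j ≤ j′ → Rectangle V i′ j′ → P (L i j) → P (L i′ j′)
  monotone G i≤i′ j≤j′ R Pij =
    monotone-column (growth-flip G) j≤j′ (rectangle-flip R)
      (monotone-column G i≤i′ (rectangle-≤ ≤-refl j≤j′ R) Pij)

nonempty-point : Growth X V M L → Rectangle V i j → L i j ≢ ∅ →
                 ∃₂ λ x y → x < i × y < j × M x y ≡ true
nonempty-point {i = zero}  {j} G R ≢∅ = ⊥-elim (≢∅ (G .west j))
nonempty-point {i = suc i} {j} G R ≢∅ with k , e ← column-edge G R | edge? e
... | no k≢idle
  with y , y<j , My ← column-point G R (k≢idle ∘ ≡-idle e) = i , y , ≤-refl , y<j , My
... | yes refl
  with x , y , x<i , y<j , Mxy ← nonempty-point G (rectangle-≤ (n≤1+n i) ≤-refl R)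
                                   (≢∅ ∘ trans (sym (idle-≡ e)))
  = x , y , m<n⇒m<1+n x<i , y<j , Mxy

-- From growth diagrams to fillings without 123 or 321

Ascent : (ℕ → ℕ → Bool) → ℕ → ℕ → Set
Ascent M i j = ∃₂ λ x₁ y₁ → ∃₂ λ x₂ y₂ →
  x₁ < x₂ × x₂ < i × y₁ < y₂ × y₂ < j × M x₁ y₁ ≡ true × M x₂ y₂ ≡ true

ascent-≤ : i ≤ i′ → j ≤ j′ → Ascent M i j → Ascent M i′ j′
ascent-≤ i≤i′ j≤j′ (_ , _ , _ , _ , x , x<i , y , y<j , M₁ , M₂) =
  _ , _ , _ , _ , x , ≤-trans x<i i≤i′ , y , ≤-trans y<j j≤j′ , M₁ , M₂

-- Traces the second column back to the cell where it arose. The point there is the upper one of the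
-- pair, and the nonempty shape under it supplies the lower one.
short-ascent : Growth inc V M L → Rectangle V i j → 0 < proj₂ (L i j) → Ascent M i j
short-ascent {i = zero} {j} G R 0<s with () ← subst (λ p → 0 < proj₂ p) (G .west j) 0<s
short-ascent {i = suc i} {zero} G R 0<s
  with () ← subst (λ p → 0 < proj₂ p) (G .south (suc i)) 0<s
short-ascent {i = suc i} {suc j} G R 0<s with inc-short (G .cell (R ≤-refl ≤-refl)) 0<s
... | inj₁ 0<q = ascent-≤ ≤-refl (n≤1+n j) (short-ascent G (rectangle-≤ ≤-refl (n≤1+n j) R) 0<q)
... | inj₂ (inj₁ 0<r) =
  ascent-≤ (n≤1+n i) ≤-refl (short-ascent G (rectangle-≤ (n≤1+n i) ≤-refl R) 0<r)
... | inj₂ (inj₂ (Mij , p≢∅))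
  with x , y , x<i , y<j , Mxy ← nonempty-point G (rectangle-≤ (n≤1+n i) (n≤1+n j) R) p≢∅
  = x , y , i , j , x<i , ≤-refl , y<j , ≤-refl , Mxy , Mij

-- On a down-closed board a rectangle lies on the board as soon as its north-east cell does. For 123
-- that cell is the last point; for 321 it has the column of the last point and the row of the
-- first.
Free : Pattern → (ℕ → ℕ → Set) → (ℕ → ℕ → Bool) → Set
Free inc V M = ∀ {x₁ x₂ x₃ y₁ y₂ y₃} → x₁ < x₂ → x₂ < x₃ → y₁ < y₂ → y₂ < y₃ →
  M x₁ y₁ ≡ true → M x₂ y₂ ≡ true → M x₃ y₃ ≡ true → ¬ V x₃ y₃
Free dec V M = ∀ {x₁ x₂ x₃ y₁ y₂ y₃} → x₁ < x₂ → x₂ < x₃ → y₂ < y₁ → y₃ < y₂ →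
  M x₁ y₁ ≡ true → M x₂ y₂ ≡ true → M x₃ y₃ ≡ true → ¬ V x₃ y₁

down-rectangle : DownClosed V → V i j → Rectangle V (suc i) (suc j)
down-rectangle down v (s≤s x≤i) (s≤s y≤j) = down x≤i y≤j v

-- The first point makes the shape at the second nonempty, hence the second point creates a second
-- column. This column is still there at the third point, where no rule applies.
growth-inc-free : DownClosed V → Growth inc V M L → Free inc V M
growth-inc-free down G x₁<x₂ x₂<x₃ y₁<y₂ y₂<y₃ M₁ M₂ M₃ v =
  inc-point-¬short (subst (Square _ _ _ _ _) M₃ (G .cell v)) short₃
  where
  R = down-rectangle down v
  v₂ = down (<⇒≤ x₂<x₃) (<⇒≤ y₂<y₃) v
  v₁ = down (<⇒≤ x₁<x₂) (<⇒≤ y₁<y₂) v₂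
  nonempty₂ = monotone edge-nonempty G x₁<x₂ y₁<y₂ (rectangle-≤ (n≤1+n _) (n≤1+n _) (down-rectangle down v₂))
    (inc-point-nonempty (subst (Square _ _ _ _ _) M₁ (G .cell v₁)))
  short₃ = monotone edge-short G x₂<x₃ y₂<y₃ (rectangle-≤ (n≤1+n _) (n≤1+n _) R)
    (inc-point-short (subst (Square _ _ _ _ _) M₂ (G .cell v₂)) nonempty₂)

dec-point-first : Square dec p q r t true → Edge first r t
dec-point-first (square _ _ g _ dec-point) = g

-- No second edge lies on the axis, and going up a column the kind becomes second only where two
-- first edges cross; `h` is the row of that crossing.
turn : Growth dec V M L → Rectangle V (suc i) j → Edge second (L i j) (L (suc i) j) →
       ∃ λ h → h < j × Edge first (L i h) (L (suc i) h) × Edge first (L i h) (L i (suc h))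
turn {i = i} {zero} G R e with () ← subst₂ (Edge second) (G .south i) (G .south (suc i)) e
turn {i = i} {suc j} G R e with dec-second (G .cell (R ≤-refl ≤-refl)) e
... | inj₂ (e₁ , f₁) = j , ≤-refl , e₁ , f₁
... | inj₁ e₂
  with h , h<j , e₁ , f₁ ← turn G (rectangle-≤ ≤-refl (n≤1+n j) R) e₂
  = h , m<n⇒m<1+n h<j , e₁ , f₁

second-persists : Growth dec V M L → h ≤ j → Rectangle V (suc i) j →
                  Edge second (L i h) (L (suc i) h) → Edge second (L i j) (L (suc i) j)
second-persists {h = h} {j} G h≤j R e with m≤n⇒m<n∨m≡n h≤j
... | inj₂ refl = e
second-persists {h = h} {suc j} G h≤j R e | inj₁ (s≤s h≤) =
  dec-second-persists (G .cell (R ≤-refl ≤-refl))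
    (second-persists G h≤ (rectangle-≤ ≤-refl (n≤1+n j) R) e)

first≢second : Edge first p q → ¬ Edge second p q
first≢second e f with () ← edge-unique e f

edge-≢ : Edge k p q → k ≢ idle → p ≢ q
edge-≢ e k≢idle = k≢idle ∘ ≡-idle e

-- A point sends a first edge up its column and another along its row; where two
-- first edges cross, both become second and remain so.  If second edges met at
-- (i , j), the crossings that made them second would give a 321, or else the two
-- first edges coming from these crossings would have crossed each other before.
free-dec-¬second² : Growth dec V M L → Rectangle V (suc i) j → Rectangle V i (suc j) →
                    (∀ {x₁ x₂ y₂ y₃} → x₁ < x₂ → x₂ < i → y₂ < j → y₃ < y₂ →
                       M x₁ j ≡ true → M x₂ y₂ ≡ true → M i y₃ ≢ true) →
                    Edge second (L i j) (L (suc i) j) → ¬ Edge second (L i j) (L i (suc j))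
free-dec-¬second² {V} {M} {L} {i} {j} G R R′ free e f
  with h , h<j , eᵢ , fᵢ ← turn G R e
     | x , x<i , fⱼ , eⱼ ← turn (growth-flip G) (rectangle-flip R′) f
  with yₚ , yₚ<h , Mₚ ← column-point G (rectangle-≤ ≤-refl (<⇒≤ h<j) R) (edge-≢ eᵢ λ ())
     | xₕ , xₕ<i , Mₕ ← column-point (growth-flip G)
         (rectangle-flip (rectangle-≤ ≤-refl (s≤s (<⇒≤ h<j)) R′)) (edge-≢ fᵢ λ ())
     | x₁ , x₁<x , M₁ ← column-point (growth-flip G)
         (rectangle-flip (rectangle-≤ (<⇒≤ x<i) ≤-refl R′)) (edge-≢ fⱼ λ ())
     | yₓ , yₓ<j , Mₓ ← column-point G (rectangle-≤ (s≤s (<⇒≤ x<i)) ≤-refl R) (edge-≢ eⱼ λ ())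
  with <-≤-connex x₁ xₕ | <-≤-connex yₚ yₓ
... | inj₁ x₁<xₕ | _ = free x₁<xₕ xₕ<i h<j yₚ<h M₁ Mₕ Mₚ
... | inj₂ _ | inj₁ yₚ<yₓ = free x₁<x x<i yₓ<j yₚ<yₓ M₁ Mₓ Mₚ
... | inj₂ xₕ≤x₁ | inj₂ yₓ≤yₚ
  with dec-cross (G .cell (R (m<n⇒m<1+n x<i) h<j))
         (column-live G (rectangle-≤ (s≤s (<⇒≤ x<i)) (<⇒≤ h<j) R) (≤-<-trans yₓ≤yₚ yₚ<h) Mₓ)
         (column-live (growth-flip G) (rectangle-flip (rectangle-≤ (<⇒≤ x<i) (s≤s (<⇒≤ h<j)) R′))
           (≤-<-trans xₕ≤x₁ x₁<x) Mₕ)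
... | inj₁ e₂ = first≢second eⱼ
      (second-persists G h<j (rectangle-≤ (s≤s (<⇒≤ x<i)) ≤-refl R) e₂)
... | inj₂ f₂ = first≢second fᵢ
      (second-persists (growth-flip G) x<i (rectangle-flip (rectangle-≤ ≤-refl (s≤s (<⇒≤ h<j)) R′)) f₂)

dec-cross-first : Square dec p q r t b → Edge first p r →
                  Edge first q t ⊎ (p ≢ q × Edge second r t)
dec-cross-first (square e f g h ρ) f₁ with edge-unique f f₁ | ρ
... | refl | vertical = inj₁ h
... | refl | cross₂₁  = inj₂ (edge-≢ e (λ ()) , g)
... | refl | dec-turn = inj₂ (edge-≢ e (λ ()) , g)

-- The point starts a first edge along its row. This edge moves on unchanged until a live column
-- crosses it, and at that crossing the top edge becomes second.
first-crossed : Growth dec V M L → x < i → Rectangle V i (suc j) → M x j ≡ true →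
                Edge first (L i j) (L i (suc j)) ⊎
                (∃ λ x′ → x < x′ × x′ < i × Edge second (L x′ (suc j)) (L (suc x′) (suc j)))
first-crossed {x = x} {suc i} {j} G x<i R Mxj with m<1+n⇒m<n∨m≡n x<i
... | inj₂ refl = inj₁ (dec-point-first (subst (Square _ _ _ _ _) Mxj
                    (square-flip (G .cell (R ≤-refl ≤-refl)))))
... | inj₁ x<i′ with first-crossed G x<i′ (rectangle-≤ (n≤1+n i) ≤-refl R) Mxj
...   | inj₂ (x′ , x<x′ , x′<i , e) = inj₂ (x′ , x<x′ , m<n⇒m<1+n x′<i , e)
...   | inj₁ f with dec-cross-first (G .cell (R ≤-refl ≤-refl)) f
...     | inj₁ f′ = inj₁ f′
...     | inj₂ (_ , e) = inj₂ (i , x<i′ , ≤-refl , e)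

-- The first edge started by the upper point meets a live column at `i` at the latest, because the
-- lower point makes column `i` live.
second-above : Growth dec V M L → x < i → y < j → Rectangle V (suc i) (suc j) →
               M x j ≡ true → M i y ≡ true →
               ∃ λ x′ → x < x′ × x′ ≤ i × Edge second (L x′ (suc j)) (L (suc x′) (suc j))
second-above {i = i} {j = j} G x<i y<j R Mxj Miy
  with first-crossed G x<i (rectangle-≤ (n≤1+n i) ≤-refl R) Mxj
... | inj₂ (x′ , x<x′ , x′<i , e) = x′ , x<x′ , <⇒≤ x′<i , e
... | inj₁ f
  with dec-cross (G .cell (R ≤-refl ≤-refl))
         (column-live G (rectangle-≤ ≤-refl (n≤1+n j) R) y<j Miy) (edge-≢ f λ ())
     | dec-cross-first (G .cell (R ≤-refl ≤-refl)) f
... | _       | inj₂ (_ , e) = i , x<i , ≤-refl , e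
... | inj₁ e  | inj₁ _       = i , x<i , ≤-refl , e
... | inj₂ f₂ | inj₁ f₁      = ⊥-elim (first≢second f₁ f₂)

-- The last two points of a 321 give a second edge in a column `x′` to the right of the middle
-- point, and the first two give one in a row `y′` above it. Both persist up to the cell
-- `(x′ , y′)`, which is on the board, and no rule lets them cross.
growth-dec-free : DownClosed V → Growth dec V M L → Free dec V M
growth-dec-free down G x₁<x₂ x₂<x₃ y₂<y₁ y₃<y₂ M₁ M₂ M₃ v
  with R ← down-rectangle down v
  with x′ , x₂<x′ , x′≤x₃ , e ← second-above G x₂<x₃ y₃<y₂ (rectangle-≤ ≤-refl (s≤s (<⇒≤ y₂<y₁)) R) M₂ M₃
     | y′ , y₂<y′ , y′≤y₁ , f ← second-above (growth-flip G) y₂<y₁ x₁<x₂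
         (rectangle-flip (rectangle-≤ (s≤s (<⇒≤ x₂<x₃)) ≤-refl R)) M₂ M₁
  = dec-¬second² (G .cell (R (s≤s x′≤x₃) (s≤s y′≤y₁)))
      (second-persists G y₂<y′ (rectangle-≤ (s≤s x′≤x₃) (m≤n⇒m≤1+n y′≤y₁) R) e)
      (second-persists (growth-flip G) x₂<x′
        (rectangle-flip (rectangle-≤ (m≤n⇒m≤1+n x′≤x₃) (s≤s y′≤y₁) R)) f)

growth-free : DownClosed V → Growth X V M L → Free X V M
growth-free {X = inc} = growth-inc-free
growth-free {X = dec} = growth-dec-free

-- From free fillings to growth diagrams

Functional : (ℕ → ℕ → Bool) → Set
Functional M = ∀ {x y y′} → M x y ≡ true → M x y′ ≡ true → y ≡ y′

idle-at-point : Functional M → Growth X V M L → Rectangle V (suc i) j →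
                M i j ≡ true → Edge k (L i j) (L (suc i) j) → k ≡ idle
idle-at-point functional G R Mij e with edge? e
... | yes k≡idle = k≡idle
... | no k≢idle
  with y , y<j , Miy ← column-point G R (edge-≢ e k≢idle)
  = ⊥-elim (<⇒≢ y<j (functional Miy Mij))

nonidle-square : Edge k p q → Edge l p r → (X ≡ dec → k ≡ second → l ≢ second) →
                 ∃ λ t → Square X p q r t false
nonidle-square idle f _ = -, square idle f idle f vertical
nonidle-square e idle _ = -, square e idle e idle horizontal
nonidle-square first second _ = -, square first second first second cross₁₂
nonidle-square second first _ = -, square second first second first cross₂₁
nonidle-square {X = inc} first first _ = -, square first first first first inc-first
nonidle-square {X = dec} first first _ = -, square first first second second dec-turn
nonidle-square {X = dec} second second ¬second² = ⊥-elim (¬second² refl refl refl)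
nonidle-square {X = inc} (second {zero}) second _ = -, square second second first first inc-turn
nonidle-square {X = inc} (second {suc d}) second _ = -, square second second second second inc-second

idle-square : (X ≡ inc → ¬ 0 < proj₂ p) → ∃ λ t → Square X p p p t true
idle-square {X = inc} {p = zero  , zero}  _ = -, square idle idle first first inc-point₁
idle-square {X = inc} {p = suc d , zero}  _ = -, square idle idle second second inc-point₂
idle-square {X = inc} {p = _     , suc s} ¬short = ⊥-elim (¬short refl (s≤s z≤n))
idle-square {X = dec} _ = -, square idle idle first first dec-point

-- `W` is the whole board and `V` the part labelled so far. A forward step can fail only at two
-- crossing second edges, excluded by `free-dec-¬second²`, or at a point over two columns, where
-- `short-ascent` would complete a 123.
extend : ∀ {W} → Functional M → Functional (flip M) → Free X W M → Growth X V M L →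
         W i j → Rectangle V (suc i) j → Rectangle V i (suc j) →
         ∃ λ t → Square X (L i j) (L (suc i) j) (L i (suc j)) t (M i j)
extend {M} {X} {V} {L} {i} {j} functional functional′ free G w R R′
  with k , e ← column-edge G R
     | l , f ← column-edge (growth-flip G) (rectangle-flip R′)
  with M i j in Mij
... | false = nonidle-square e f λ { refl refl refl → free-dec-¬second² G R R′
        (λ x₁<x₂ x₂<i y₂<j y₃<y₂ M₁ M₂ M₃ → free x₁<x₂ x₂<i y₂<j y₃<y₂ M₁ M₂ M₃ w) e f }
... | true
  with refl ← idle-at-point functional G R Mij e
     | refl ← idle-at-point functional′ (growth-flip G) (rectangle-flip R′) Mij f
  with L i j in p≡ | L (suc i) j | L i (suc j) | e | f
... | p | _ | _ | idle | idle = idle-square ¬short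
  where
  ¬short : X ≡ inc → ¬ 0 < proj₂ p
  ¬short refl 0<s
    with _ , _ , _ , _ , x₁<x₂ , x₂<i , y₁<y₂ , y₂<j , M₁ , M₂ ←
           short-ascent G (rectangle-≤ (n≤1+n i) ≤-refl R) (subst (λ p → 0 < proj₂ p) (sym p≡) 0<s)
    = free x₁<x₂ x₂<i y₁<y₂ y₂<j M₁ M₂ Mij w

module _ {V : ℕ → ℕ → Set} (V? : ∀ i j → Dec (V i j)) where

  -- ∅ off the board, so that the filling determines every label.
  labels : Pattern → (ℕ → ℕ → Bool) → ℕ → ℕ → Shape
  labels X M zero    _       = ∅
  labels X M (suc i) zero    = ∅
  labels X M (suc i) (suc j) =
    if does (V? i j)
    then ahead X (labels X M i j) (labels X M (suc i) j) (labels X M i (suc j)) (M i j)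
    else ∅

  labels-inside : V i j → labels X M (suc i) (suc j) ≡
    ahead X (labels X M i j) (labels X M (suc i) j) (labels X M i (suc j)) (M i j)
  labels-inside {i} {j} v rewrite dec-true (V? i j) v = refl

  labels-outside : ¬ V i j → labels X M (suc i) (suc j) ≡ ∅
  labels-outside {i} {j} ¬v rewrite dec-false (V? i j) ¬v = refl

  labels-south : ∀ i → labels X M i 0 ≡ ∅
  labels-south zero    = refl
  labels-south (suc i) = refl

  module _ (down : DownClosed V) (functional : Functional M) (functional′ : Functional (flip M))
           (free : Free X V M) where

    -- Induction by antidiagonals: the cells below the new one in its column and to the left of it
    -- in its row, with all cells south-west of these, have a smaller `i + j`, as `extend` requires.
    labels-growth-below : ∀ m → Growth X (λ i j → V i j × i + j < m) M (labels X M)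
    labels-growth-below m .west  _ = refl
    labels-growth-below m .south   = labels-south
    labels-growth-below (suc m) .cell {i} {j} (v , s≤s i+j≤m)
      rewrite labels-inside {X = X} {M = M} v
      with t , S ← extend functional functional′ free (labels-growth-below m) v
             (λ { {x} {y} (s≤s x≤i) y<j → down x≤i (<⇒≤ y<j) v ,
                  ≤-trans (+-mono-≤-< x≤i y<j) i+j≤m })
             (λ { {x} {y} x<i (s≤s y≤j) → down (<⇒≤ x<i) y≤j v ,
                  ≤-trans (+-mono-<-≤ x<i y≤j) i+j≤m })
      = subst (λ t → Square X _ _ _ t _) (sym (ahead-square S)) S

    labels-growth : Growth X V M (labels X M)
    labels-growth .west _ = refl
    labels-growth .south  = labels-south
    labels-growth .cell {i} {j} v = labels-growth-below (suc (i + j)) .cell (v , ≤-refl)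

edge-from-∅ : Edge k p q → q ≡ ∅ → p ≡ ∅
edge-from-∅ idle refl = refl

-- Finite boards and the rules run backwards

record Board (n : ℕ) (V : ℕ → ℕ → Set) : Set where
  field
    cell? : ∀ i j → Dec (V i j)
    down  : DownClosed V
    bound : V i j → i < n × j < n

module _ {n} {V : ℕ → ℕ → Set} (board : Board n V) where
  open Board board

  -- Works inwards from the north-east. The arguments `a` and `b` of `go` bound the distances to
  -- `n`, beyond which there are no cells.
  board-induction : (P : ℕ → ℕ → Set) → (∀ i j → ¬ V i j → P i j) →
    (∀ i j → V i j → P (suc i) j → P i (suc j) → P (suc i) (suc j) → P i j) →
    ∀ i j → P i j
  board-induction P outside inside i j = go n n i j (m≤n+m n i) (m≤n+m n j)
    where
    go : ∀ a b i j → n ≤ i + a → n ≤ j + b → P i j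
    go a b i j n≤i+a n≤j+b with cell? i j
    ... | no ¬v = outside i j ¬v
    go zero b i j n≤i+a n≤j+b | yes v =
      ⊥-elim (<⇒≱ (proj₁ (bound v)) (≤-trans n≤i+a (≤-reflexive (+-identityʳ i))))
    go (suc a) zero i j n≤i+a n≤j+b | yes v =
      ⊥-elim (<⇒≱ (proj₂ (bound v)) (≤-trans n≤j+b (≤-reflexive (+-identityʳ j))))
    go (suc a) (suc b) i j n≤i+a n≤j+b | yes v =
      inside i j v (go a (suc b) (suc i) j n≤ n≤j+b) (go (suc a) b i (suc j) n≤i+a n≤′)
        (go a b (suc i) (suc j) n≤ n≤′)
      where
      n≤  = ≤-trans n≤i+a (≤-reflexive (+-suc i a))
      n≤′ = ≤-trans n≤j+b (≤-reflexive (+-suc j b))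

  -- `behind` recovers the south-west label and the content of a cell from its other three labels,
  -- so the labels on the border determine the rest.
  growth-unique : Growth X V M L → Growth X V M′ L′ → (∀ {i j} → ¬ V i j → L i j ≡ L′ i j) →
                  ∀ i j → L i j ≡ L′ i j × (V i j → M i j ≡ M′ i j)
  growth-unique {X} {M} {L} {M′} {L′} G G′ outer =
    board-induction _ (λ i j ¬v → outer ¬v , ⊥-elim ∘ ¬v)
      λ i j v (q≡ , _) (r≡ , _) (t≡ , _) → let eq = same v q≡ r≡ t≡ in cong proj₁ eq , λ _ → cong proj₂ eq
    where
    same : ∀ {i j} → V i j → L (suc i) j ≡ L′ (suc i) j → L i (suc j) ≡ L′ i (suc j) →
           L (suc i) (suc j) ≡ L′ (suc i) (suc j) → (L i j , M i j) ≡ (L′ i j , M′ i j)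
    same v q≡ r≡ t≡ = trans (sym (behind-square (G .cell v)))
      (trans (cong₂ (λ (q , r) t → behind X q r t) (cong₂ _,_ q≡ r≡) t≡) (behind-square (G′ .cell v)))

  -- Serves to recognise a diagram, such as a transposed one, from its filling: inside the board
  -- `ahead` leaves no choice.
  growth-labels : Growth X V M L → (∀ {i j} → ¬ V i j → L (suc i) (suc j) ≡ ∅) →
                  ∀ i j → L i j ≡ labels cell? X M i j
  growth-labels G out zero j = G .west j
  growth-labels G out (suc i) zero = G .south (suc i)
  growth-labels {X} {M} {L} G out (suc i) (suc j) with cell? i j
  ... | no ¬v = out ¬v
  ... | yes v
    rewrite sym (growth-labels G out i j) | sym (growth-labels G out (suc i) j)
          | sym (growth-labels G out i (suc j)) = sym (ahead-square (G .cell v))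

  module _ (Y : Pattern) (L : ℕ → ℕ → Shape) where

    -- Runs the rules of Y backwards from the labels L on and beyond the border; the
    -- recursion is on the distances of i and j to n.
    retreat : ℕ → ℕ → ℕ → ℕ → Shape
    retreat zero    b       i j = L i j
    retreat (suc a) zero    i j = L i j
    retreat (suc a) (suc b) i j =
      if does (cell? i j)
      then proj₁ (behind Y (retreat a (suc b) (suc i) j) (retreat (suc a) b i (suc j))
                           (retreat a b (suc i) (suc j)))
      else L i j

    relabel : ℕ → ℕ → Shape
    relabel i j = retreat (n ∸ i) (n ∸ j) i j

    relabel-outside : ¬ V i j → relabel i j ≡ L i j
    relabel-outside {i} {j} ¬v with n ∸ i | n ∸ j
    ... | zero  | _    = refl
    ... | suc _ | zero = refl
    ... | suc _ | suc _ rewrite dec-false (cell? i j) ¬v = refl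

    recell : ℕ → ℕ → Shape × Bool
    recell i j = behind Y (relabel (suc i) j) (relabel i (suc j)) (relabel (suc i) (suc j))

    relabel-inside : V i j → relabel i j ≡ proj₁ (recell i j)
    relabel-inside {i} {j} v
      -- The bounds turn `n ∸ i` into `suc (n ∸ suc i)`, and likewise for `j`, which exposes the
      -- last clause of `retreat`.
      rewrite +-∸-assoc 1 (proj₁ (bound v)) | +-∸-assoc 1 (proj₂ (bound v)) | dec-true (cell? i j) v = refl

    -- The top and right edges of a cell belong to neighbouring cells treated before or, at the
    -- border, to the old diagram, whose labels are kept there. The notion of edge does not mention
    -- the pattern, so both kinds can be fed to the rules of `Y`.
    relabel-square : Growth X V M L → ∀ i j → V i j →
      Square Y (relabel i j) (relabel (suc i) j) (relabel i (suc j)) (relabel (suc i) (suc j))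
               (proj₂ (recell i j))
    relabel-square G = board-induction _ (λ i j ¬v v → ⊥-elim (¬v v))
      λ i j v right above _ _ → subst
        (λ p → Square Y p ⟨ suc i , j ⟩ ⟨ i , suc j ⟩ ⟨ suc i , suc j ⟩ (proj₂ (recell i j)))
        (sym (relabel-inside v))
        (behind-exists (proj₂ (top v above)) (proj₂ (side v right)))
      where
      ⟨_,_⟩ = relabel
      top : V i j → (V i (suc j) → Square Y ⟨ i , suc j ⟩ ⟨ suc i , suc j ⟩ ⟨ i , 2 + j ⟩
              ⟨ suc i , 2 + j ⟩ b) → ∃ λ k → Edge k ⟨ i , suc j ⟩ ⟨ suc i , suc j ⟩
      top {i} {j} v above with cell? i (suc j)
      ... | yes v′ = -, Square.bottom (above v′)
      ... | no ¬v′
        rewrite relabel-outside ¬v′ | relabel-outside (¬v′ ∘ down (n≤1+n i) ≤-refl)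
        = -, Square.top (G .cell v)
      side : V i j → (V (suc i) j → Square Y ⟨ suc i , j ⟩ ⟨ 2 + i , j ⟩ ⟨ suc i , suc j ⟩
               ⟨ 2 + i , suc j ⟩ b) → ∃ λ k → Edge k ⟨ suc i , j ⟩ ⟨ suc i , suc j ⟩
      side {i} {j} v right with cell? (suc i) j
      ... | yes v′ = -, Square.left (right v′)
      ... | no ¬v′
        rewrite relabel-outside ¬v′ | relabel-outside (¬v′ ∘ down ≤-refl (n≤1+n j))
        = -, Square.right (G .cell v)

    relabel-growth : Growth X V M L → Growth Y V (λ i j → proj₂ (recell i j)) relabel
    relabel-growth G .cell {i} {j} v = relabel-square G i j v
    -- The axis is empty where it leaves the board, and an edge into the empty shape starts at the
    -- empty shape.
    relabel-growth G .west j = board-induction (λ i j → i ≡ 0 → relabel i j ≡ ∅)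
      (λ { _ j ¬v refl → trans (relabel-outside ¬v) (G .west j) })
      (λ { _ j v _ above _ refl → edge-from-∅ (Square.left (relabel-square G _ j v)) (above refl) })
      0 j refl
    relabel-growth G .south i = board-induction (λ i j → j ≡ 0 → relabel i j ≡ ∅)
      (λ { i _ ¬v refl → trans (relabel-outside ¬v) (G .south i) })
      (λ { i _ v right _ _ refl → edge-from-∅ (Square.bottom (relabel-square G i _ v)) (right refl) })
      i 0 refl

  column-top : ∀ i y → V i y → ∃ λ h → y ≤ h × V i h × ¬ V i (suc h)
  column-top = board-induction _ (λ i y ¬v v → ⊥-elim (¬v v)) top
    where
    top : ∀ i y → V i y → _ → (V i (suc y) → ∃ λ h → suc y ≤ h × V i h × ¬ V i (suc h)) → _ →
          V i y → ∃ λ h → y ≤ h × V i h × ¬ V i (suc h)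
    top i y v _ above _ _ with cell? i (suc y)
    ... | no ¬v′ = y , ≤-refl , v , ¬v′
    ... | yes v′ with h , y<h , v″ , ¬v″ ← above v′ = h , <⇒≤ y<h , v″ , ¬v″

  -- Both diagrams have the same edge where column `i` meets the border, and whether this edge is
  -- live tells whether the column has a point on the board.
  column-transfer : Growth X V M L → Growth Y V M′ L′ → (∀ {i j} → ¬ V i j → L i j ≡ L′ i j) →
    ∀ {i y} → V i y → M i y ≡ true → ∃ λ y′ → V i y′ × M′ i y′ ≡ true
  column-transfer G G′ outer {i} {y} v Miy
    with h , y≤h , v′ , ¬v′ ← column-top i y v
    with R ← down-rectangle down v′
    with y′ , s≤s y′≤h , M′iy′ ← column-point G′ R (λ eq → column-live G R (s≤s y≤h) Miy
           (trans (outer ¬v′) (trans eq (sym (outer (¬v′ ∘ down (n≤1+n i) ≤-refl))))))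
    = y′ , down ≤-refl y′≤h v′ , M′iy′

-- A point needs an idle bottom edge, which a lower point in its column would make live.
growth-functional : ∀ {y′} → DownClosed V → Growth X V M L →
  V x y → V x y′ → M x y ≡ true → M x y′ ≡ true → y ≡ y′
growth-functional {V} {M = M} down G v v′ Mxy Mxy′ =
  ≤-antisym (≮⇒≥ λ y′<y → below v y′<y Mxy Mxy′) (≮⇒≥ λ y<y′ → below v′ y<y′ Mxy′ Mxy)
  where
  below : ∀ {x y z} → V x y → z < y → M x y ≡ true → M x z ≢ true
  below v z<y Mxy Mxz =
    column-live G (rectangle-≤ ≤-refl (n≤1+n _) (down-rectangle down v)) z<y Mxz
      (point-bottom (subst (Square _ _ _ _ _) Mxy (G .cell v)))

-- Exchanging the filling of a symmetric board

module Splice {n V} (board : Board n V) (V-flip : ∀ {x y} → V x y → V y x)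
  (growth : Growth X V M L) (growth′ : Growth Y V M′ L′)
  (border : ∀ {x y} → ¬ V x y → L x y ≡ L′ x y)
  (M-sym : ∀ x y → M x y ≡ M y x) (M-functional : Functional M)
  (M′-sym : ∀ {x y} → V x y → M′ x y ≡ M′ y x) where

  open Board board

  splice : ℕ → ℕ → Bool
  splice x y = if does (cell? x y) then M′ x y else M x y

  splice-inside : V x y → splice x y ≡ M′ x y
  splice-inside {x} {y} v rewrite dec-true (cell? x y) v = refl

  splice-outside : ¬ V x y → splice x y ≡ M x y
  splice-outside {x} {y} ¬v rewrite dec-false (cell? x y) ¬v = refl

  splice-sym : ∀ x y → splice x y ≡ splice y x
  splice-sym x y with cell? x y
  ... | yes v = trans (M′-sym v) (sym (splice-inside (V-flip v)))
  ... | no ¬v = trans (M-sym x y) (sym (splice-outside (¬v ∘ V-flip)))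

  private
    -- A column with a new point on the board had an old point on the board too, so its only old
    -- point cannot lie off the board.
    ¬mixed : ∀ {x y y′} → V x y → ¬ V x y′ → M′ x y ≡ true → M x y′ ≢ true
    ¬mixed v ¬v′ M′xy Mxy′
      with z , v″ , Mxz ← column-transfer board growth′ growth (sym ∘ border) v M′xy
      = ¬v′ (subst (V _) (M-functional Mxz Mxy′) v″)

  splice-functional : Functional splice
  splice-functional {x} {y} {y′} eq eq′ with cell? x y | cell? x y′
  ... | yes v | yes v′ = growth-functional down growth′ v v′ eq eq′
  ... | yes v | no ¬v′ = ⊥-elim (¬mixed v ¬v′ eq eq′)
  ... | no ¬v | yes v′ = ⊥-elim (¬mixed v′ ¬v eq′ eq)
  ... | no ¬v | no ¬v′ = M-functional eq eq′

  splice-bound : (∀ {x y} → M x y ≡ true → x < n × y < n) →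
                 ∀ {x y} → splice x y ≡ true → x < n × y < n
  splice-bound M-bound {x} {y} eq with cell? x y
  ... | yes v = bound v
  ... | no _  = M-bound eq

  splice-total : M x y ≡ true → ∃ λ y′ → splice x y′ ≡ true
  splice-total {x} {y} Mxy with cell? x y
  ... | no ¬v = y , trans (splice-outside ¬v) Mxy
  ... | yes v with y′ , v′ , M′xy′ ← column-transfer board growth growth′ border v Mxy
    = y′ , trans (splice-inside v′) M′xy′

record Exchange (X Y : Pattern) (n : ℕ) (V : ℕ → ℕ → Set) (M : ℕ → ℕ → Bool) : Set where
  field
    {before after} : ℕ → ℕ → Shape
    filling    : ℕ → ℕ → Bool
    growth     : Growth X V M before
    growth′    : Growth Y V filling after
    border     : ∀ {x y} → ¬ V x y → before x y ≡ after x y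
    outside    : ∀ {x y} → ¬ V x y → after (suc x) (suc y) ≡ ∅
    agree      : ∀ {x y} → ¬ V x y → M x y ≡ filling x y
    symmetric  : ∀ x y → filling x y ≡ filling y x
    functional : Functional filling
    bounded    : ∀ {x y} → filling x y ≡ true → x < n × y < n
    total      : ∀ {x y} → M x y ≡ true → ∃ λ y′ → filling x y′ ≡ true

module _ {n} {V : ℕ → ℕ → Set} (board : Board n V) (V-flip : ∀ {x y} → V x y → V y x)
         (M-sym : ∀ x y → M x y ≡ M y x) (M-functional : Functional M)
         (M-bound : ∀ {x y} → M x y ≡ true → x < n × y < n) where

  open Board board

  exchange : Free X V M → Exchange X Y n V M
  exchange {X} {Y} free = record
    { growth     = G
    ; growth′    = growth-resp id (sym ∘ splice-inside) G′
    ; border     = sym ∘ unchanged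
    ; outside    = λ ¬v → trans (unchanged (¬v ∘ down (n≤1+n _) (n≤1+n _))) (labels-outside cell? ¬v)
    ; agree      = sym ∘ splice-outside
    ; symmetric  = splice-sym
    ; functional = splice-functional
    ; bounded    = splice-bound M-bound
    ; total      = splice-total
    }
    where
    unchanged : ∀ {x y} → ¬ V x y → relabel board Y (labels cell? X M) x y ≡ labels cell? X M x y
    unchanged = relabel-outside board Y (labels cell? X M)

    G : Growth X V M (labels cell? X M)
    G = labels-growth cell? down M-functional
          (λ eq eq′ → M-functional (trans (M-sym _ _) eq) (trans (M-sym _ _) eq′)) free

    G′ : Growth Y V (λ x y → proj₂ (recell board Y (labels cell? X M) x y))
                    (relabel board Y (labels cell? X M))
    G′ = relabel-growth board Y (labels cell? X M) G

    -- The transposed labels form a growth diagram of the same symmetric filling and are also empty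
    -- beyond the border.
    labels-sym : ∀ x y → labels cell? X M x y ≡ labels cell? X M y x
    labels-sym x y = sym (growth-labels board
      (growth-resp V-flip (λ {x} {y} _ → M-sym y x) (growth-flip G))
      (λ ¬v → labels-outside cell? (¬v ∘ V-flip)) x y)

    -- The new filling is symmetric on the board because the relabelled diagram and its transpose
    -- agree on the border, by `labels-sym`.
    open Splice board V-flip G G′ (sym ∘ unchanged) M-sym M-functional
      (λ {x} {y} → proj₂ (growth-unique board G′
        (growth-resp V-flip (λ _ → refl) (growth-flip G′))
        (λ {i} {j} ¬v → trans (unchanged ¬v) (trans (labels-sym i j) (sym (unchanged (¬v ∘ V-flip))))) x y))

-- Involutions

↑-elim : (P : Fin (j + m) → Set) → (∀ a → P (a ↑ˡ m)) → (∀ b → P (j ↑ʳ b)) → ∀ c → P c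
↑-elim {j} {m} P f g c = subst P (join-splitAt j m c) (go (Fin.splitAt j c))
  where
  go : ∀ s → P (Fin.join j m s)
  go (inj₁ a) = f a
  go (inj₂ b) = g b

Below : Vec (Fin n) n → Vec (Fin n) j → Vec (Fin n) m → Set
Below π ι κ = ∀ a b → lookup ι a Fin.< lookup κ b × lookup π (lookup ι a) Fin.< lookup π (lookup κ b)

module _ (α : Vec (Fin j) j) (τ : Vec (Fin m) m) where

  lookup-⊕ˡ : ∀ a → toℕ (lookup (α ⊕ τ) (a ↑ˡ m)) ≡ toℕ (lookup α a)
  lookup-⊕ˡ a rewrite lookup-++ˡ (map (_↑ˡ m) α) (map (j ↑ʳ_) τ) a | lookup-map a (_↑ˡ m) α = toℕ-↑ˡ _ m

  lookup-⊕ʳ : ∀ b → toℕ (lookup (α ⊕ τ) (j ↑ʳ b)) ≡ j + toℕ (lookup τ b)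
  lookup-⊕ʳ b rewrite lookup-++ʳ (map (_↑ˡ m) α) (map (j ↑ʳ_) τ) b | lookup-map b (j ↑ʳ_) τ = toℕ-↑ʳ j _

  module _ (π : Vec (Fin n) n) (ι : Vec (Fin n) j) (κ : Vec (Fin n) m) where

    -- Comparisons between the two blocks are settled by `Below` in `π`, and in `α ⊕ τ` by the
    -- letters of `α` being less than `j` and the others at least `j`.
    occurrence-⊕⁺ : IsOccurrence π α ι → IsOccurrence π τ κ → Below π ι κ →
                    IsOccurrence π (α ⊕ τ) (ι ++ κ)
    occurrence-⊕⁺ (ι-mono , ι⇔) (κ-mono , κ⇔) below =
      (λ {c} {d} → ↑-elim (λ c → ∀ d → Mono c d) (λ a → ↑-elim _ (ll a) (lr a))
                          (λ b → ↑-elim _ (rl b) (rr b)) c d) ,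
      ↑-elim _ (λ a → ↑-elim _ (ll⇔ a) (lr⇔ a)) (λ b → ↑-elim _ (rl⇔ b) (rr⇔ b))
      where
      Mono : Fin (j + m) → Fin (j + m) → Set
      Mono c d = c Fin.< d → lookup (ι ++ κ) c Fin.< lookup (ι ++ κ) d
      ll : ∀ a a′ → Mono (a ↑ˡ m) (a′ ↑ˡ m)
      ll a a′ rewrite lookup-++ˡ ι κ a | lookup-++ˡ ι κ a′ | toℕ-↑ˡ a m | toℕ-↑ˡ a′ m = ι-mono
      lr : ∀ a b → Mono (a ↑ˡ m) (j ↑ʳ b)
      lr a b _ rewrite lookup-++ˡ ι κ a | lookup-++ʳ ι κ b = proj₁ (below a b)
      rl : ∀ b a → Mono (j ↑ʳ b) (a ↑ˡ m)
      rl b a b<a rewrite toℕ-↑ˡ a m | toℕ-↑ʳ j b = ⊥-elim (m+n≮m j _ (<-trans b<a (toℕ<n a)))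
      rr : ∀ b b′ → Mono (j ↑ʳ b) (j ↑ʳ b′)
      rr b b′ rewrite lookup-++ʳ ι κ b | lookup-++ʳ ι κ b′ | toℕ-↑ʳ j b | toℕ-↑ʳ j b′ =
        κ-mono ∘ +-cancelˡ-< j _ _
      Iff : Fin (j + m) → Fin (j + m) → Set
      Iff c d = lookup π (lookup (ι ++ κ) c) Fin.< lookup π (lookup (ι ++ κ) d) ⇔
                lookup (α ⊕ τ) c Fin.< lookup (α ⊕ τ) d
      ll⇔ : ∀ a a′ → Iff (a ↑ˡ m) (a′ ↑ˡ m)
      ll⇔ a a′ rewrite lookup-++ˡ ι κ a | lookup-++ˡ ι κ a′ | lookup-⊕ˡ a | lookup-⊕ˡ a′ = ι⇔ a a′
      lr⇔ : ∀ a b → Iff (a ↑ˡ m) (j ↑ʳ b)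
      lr⇔ a b rewrite lookup-++ˡ ι κ a | lookup-++ʳ ι κ b | lookup-⊕ˡ a | lookup-⊕ʳ b =
        mk⇔ (λ _ → ≤-trans (toℕ<n (lookup α a)) (m≤m+n j _)) (λ _ → proj₂ (below a b))
      rl⇔ : ∀ b a → Iff (j ↑ʳ b) (a ↑ˡ m)
      rl⇔ b a rewrite lookup-++ˡ ι κ a | lookup-++ʳ ι κ b | lookup-⊕ˡ a | lookup-⊕ʳ b =
        mk⇔ (λ π< → ⊥-elim (<-asym π< (proj₂ (below a b))))
            (λ α< → ⊥-elim (m+n≮m j _ (<-trans α< (toℕ<n (lookup α a)))))
      rr⇔ : ∀ b b′ → Iff (j ↑ʳ b) (j ↑ʳ b′)
      rr⇔ b b′ rewrite lookup-++ʳ ι κ b | lookup-++ʳ ι κ b′ | lookup-⊕ʳ b | lookup-⊕ʳ b′ =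
        mk⇔ (+-monoʳ-< j ∘ Equivalence.to (κ⇔ b b′)) (Equivalence.from (κ⇔ b b′) ∘ +-cancelˡ-< j _ _)

    occurrence-⊕⁻ : IsOccurrence π (α ⊕ τ) (ι ++ κ) →
                    IsOccurrence π α ι × IsOccurrence π τ κ × Below π ι κ
    occurrence-⊕⁻ (mono , iff) =
      ((λ {a} {a′} → ι-mono a a′) , ι⇔) , ((λ {b} {b′} → κ-mono b b′) , κ⇔) , λ a b → pos a b , val a b
      where
      ι-mono : ∀ a a′ → a Fin.< a′ → lookup ι a Fin.< lookup ι a′
      ι-mono a a′ with h ← mono {a ↑ˡ m} {a′ ↑ˡ m}
        rewrite lookup-++ˡ ι κ a | lookup-++ˡ ι κ a′ | toℕ-↑ˡ a m | toℕ-↑ˡ a′ m = h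
      κ-mono : ∀ b b′ → b Fin.< b′ → lookup κ b Fin.< lookup κ b′
      κ-mono b b′ with h ← mono {j ↑ʳ b} {j ↑ʳ b′}
        rewrite lookup-++ʳ ι κ b | lookup-++ʳ ι κ b′ | toℕ-↑ʳ j b | toℕ-↑ʳ j b′ = h ∘ +-monoʳ-< j
      ι⇔ : ∀ a a′ → lookup π (lookup ι a) Fin.< lookup π (lookup ι a′) ⇔ lookup α a Fin.< lookup α a′
      ι⇔ a a′ with h ← iff (a ↑ˡ m) (a′ ↑ˡ m)
        rewrite lookup-++ˡ ι κ a | lookup-++ˡ ι κ a′ | lookup-⊕ˡ a | lookup-⊕ˡ a′ = h
      κ⇔ : ∀ b b′ → lookup π (lookup κ b) Fin.< lookup π (lookup κ b′) ⇔ lookup τ b Fin.< lookup τ b′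
      κ⇔ b b′ with h ← iff (j ↑ʳ b) (j ↑ʳ b′)
        rewrite lookup-++ʳ ι κ b | lookup-++ʳ ι κ b′ | lookup-⊕ʳ b | lookup-⊕ʳ b′ =
        mk⇔ (+-cancelˡ-< j _ _ ∘ Equivalence.to h) (Equivalence.from h ∘ +-monoʳ-< j)
      pos : ∀ a b → lookup ι a Fin.< lookup κ b
      pos a b with h ← mono {a ↑ˡ m} {j ↑ʳ b}
        rewrite lookup-++ˡ ι κ a | lookup-++ʳ ι κ b | toℕ-↑ˡ a m | toℕ-↑ʳ j b =
        h (≤-trans (toℕ<n a) (m≤m+n j _))
      val : ∀ a b → lookup π (lookup ι a) Fin.< lookup π (lookup κ b)
      val a b with h ← iff (a ↑ˡ m) (j ↑ʳ b)
        rewrite lookup-++ˡ ι κ a | lookup-++ʳ ι κ b | lookup-⊕ˡ a | lookup-⊕ʳ b =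
        Equivalence.from h (≤-trans (toℕ<n (lookup α a)) (m≤m+n j _))

prefix : Pattern → Vec (Fin 3) 3
prefix inc = 0F ∷ 1F ∷ 2F ∷ []
prefix dec = 2F ∷ 1F ∷ 0F ∷ []

prefix-injective : ∀ X a b → toℕ (lookup (prefix X) a) ≡ toℕ (lookup (prefix X) b) → a ≡ b
prefix-injective inc = from-yes (Fin.all? λ a → Fin.all? λ b →
  toℕ (lookup (prefix inc) a) ≟ toℕ (lookup (prefix inc) b) →-dec a Fin.≟ b)
prefix-injective dec = from-yes (Fin.all? λ a → Fin.all? λ b →
  toℕ (lookup (prefix dec) a) ≟ toℕ (lookup (prefix dec) b) →-dec a Fin.≟ b)

-- By trichotomy: the values of `g` are distinct, so preserving their order already forces
-- reflecting it.
<-reflect : ∀ {k} {f g : Fin k → ℕ} → (∀ a b → g a ≡ g b → a ≡ b) →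
            (∀ a b → g a < g b → f a < f b) → ∀ a b → f a < f b ⇔ g a < g b
<-reflect {f = f} {g} g-injective mono a b = mk⇔ to (mono a b)
  where
  to : f a < f b → g a < g b
  to fa<fb with <-cmp (g a) (g b)
  ... | tri< ga<gb _ _ = ga<gb
  ... | tri≈ _ ga≡gb _ = ⊥-elim (<⇒≢ fa<fb (cong f (g-injective a b ga≡gb)))
  ... | tri> _ _ gb<ga = ⊥-elim (<-asym fa<fb (mono b a gb<ga))

<-lookup₃ : ∀ {A : Set} (f : A → ℕ) {a b c} → f a < f b → f b < f c →
            ∀ x y → x Fin.< y → f (lookup (a ∷ b ∷ c ∷ []) x) < f (lookup (a ∷ b ∷ c ∷ []) y)
<-lookup₃ f fa<fb fb<fc 0F 1F _ = fa<fb
<-lookup₃ f fa<fb fb<fc 0F 2F _ = <-trans fa<fb fb<fc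
<-lookup₃ f fa<fb fb<fc 1F 2F _ = fb<fc
<-lookup₃ f fa<fb fb<fc 1F 1F (s≤s ())
<-lookup₃ f fa<fb fb<fc 2F 1F (s≤s ())
<-lookup₃ f fa<fb fb<fc 2F 2F (s≤s (s≤s ()))

>-lookup₃ : ∀ {A : Set} (f : A → ℕ) {a b c} → f b < f a → f c < f b → ∀ x y →
            lookup (prefix dec) x Fin.< lookup (prefix dec) y →
            f (lookup (a ∷ b ∷ c ∷ []) x) < f (lookup (a ∷ b ∷ c ∷ []) y)
>-lookup₃ f fb<fa fc<fb 1F 0F _ = fb<fa
>-lookup₃ f fb<fa fc<fb 2F 0F _ = <-trans fc<fb fb<fa
>-lookup₃ f fb<fa fc<fb 2F 1F _ = fc<fb
>-lookup₃ f fb<fa fc<fb 0F 2F ()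
>-lookup₃ f fb<fa fc<fb 1F 2F ()
>-lookup₃ f fb<fa fc<fb 2F 2F ()
>-lookup₃ f fb<fa fc<fb 0F 0F (s≤s (s≤s ()))
>-lookup₃ f fb<fa fc<fb 0F 1F (s≤s ())
>-lookup₃ f fb<fa fc<fb 1F 1F (s≤s ())

occurrence-inc : ∀ (π : Vec (Fin n) n) {a b c} → a Fin.< b → b Fin.< c →
  lookup π a Fin.< lookup π b → lookup π b Fin.< lookup π c →
  IsOccurrence π (prefix inc) (a ∷ b ∷ c ∷ [])
occurrence-inc π a<b b<c πa<πb πb<πc =
  (λ {x} {y} → <-lookup₃ toℕ a<b b<c x y) ,
  <-reflect (prefix-injective inc)
    (λ { 0F 1F _ → πa<πb ; 0F 2F _ → <-trans πa<πb πb<πc ; 1F 2F _ → πb<πc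
       ; 1F 1F (s≤s ()) ; 2F 1F (s≤s ()) ; 2F 2F (s≤s (s≤s ())) })

occurrence-dec : ∀ (π : Vec (Fin n) n) {a b c} → a Fin.< b → b Fin.< c →
  lookup π b Fin.< lookup π a → lookup π c Fin.< lookup π b →
  IsOccurrence π (prefix dec) (a ∷ b ∷ c ∷ [])
occurrence-dec π a<b b<c πb<πa πc<πb =
  (λ {x} {y} → <-lookup₃ toℕ a<b b<c x y) ,
  <-reflect (prefix-injective dec) (>-lookup₃ (toℕ ∘ lookup π) πb<πa πc<πb)

-- Permutation matrices and the board cut out by occurrences of τ

module _ (π : Vec (Fin n) n) where

  Dot : ℕ → ℕ → Set
  Dot x y = ∃ λ i → toℕ i ≡ x × toℕ (lookup π i) ≡ y

  dot? : ∀ x y → Dec (Dot x y)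
  dot? x y = Fin.any? λ i → toℕ i ≟ x ×-dec toℕ (lookup π i) ≟ y

  dots : ℕ → ℕ → Bool
  dots x y = does (dot? x y)

  dots⁺ : ∀ i → dots (toℕ i) (toℕ (lookup π i)) ≡ true
  dots⁺ i = dec-true (dot? _ _) (i , refl , refl)

  dots⁻ : ∀ {x y} → dots x y ≡ true → Dot x y
  dots⁻ {x} {y} eq with dot? x y
  ... | yes d = d
  ... | no _ with () ← eq

  dots-lookup : ∀ {i j} → dots (toℕ i) (toℕ j) ≡ true → lookup π i ≡ j
  dots-lookup {i} {j} eq with i′ , i≡ , j≡ ← dots⁻ eq
    rewrite toℕ-injective i≡ = toℕ-injective j≡

  dots-bound : ∀ {x y} → dots x y ≡ true → x < n × y < n
  dots-bound eq with i , refl , refl ← dots⁻ eq = toℕ<n i , toℕ<n _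

  dots-functional : Functional dots
  dots-functional eq eq′ with i , refl , refl ← dots⁻ eq | i′ , i≡ , refl ← dots⁻ eq′
    rewrite toℕ-injective i≡ = refl

  module _ (involutive : ∀ i → lookup π (lookup π i) ≡ i) where

    dots-flip : ∀ {x y} → dots x y ≡ true → dots y x ≡ true
    dots-flip eq with i , refl , refl ← dots⁻ eq =
      subst (λ i′ → dots (toℕ (lookup π i)) (toℕ i′) ≡ true) (involutive i) (dots⁺ (lookup π i))

    dots-sym : ∀ x y → dots x y ≡ dots y x
    dots-sym x y = ⇔→≡ (mk⇔ dots-flip dots-flip)

    dots-functional′ : Functional (flip dots)
    dots-functional′ eq eq′ = dots-functional (dots-flip eq) (dots-flip eq′)

  module _ (τ : Vec (Fin m) m) where

    Beyond : ℕ → ℕ → Set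
    Beyond x y = ∃ λ κ → IsOccurrence π τ κ ×
      (∀ b → x < toℕ (lookup κ b) × y < toℕ (lookup π (lookup κ b)))

    beyond? : ∀ x y → Dec (Beyond x y)
    beyond? x y = map′ (λ p → let κ , _ , o = find p in κ , o) (λ (κ , o) → lose (words-complete κ) o)
      (Any.any? (λ κ → isOccurrence? π τ κ ×-dec
        Fin.all? λ b → x <? toℕ (lookup κ b) ×-dec y <? toℕ (lookup π (lookup κ b))) (words n m))

    beyond-≤ : ∀ {x x′ y y′} → x′ ≤ x → y′ ≤ y → Beyond x y → Beyond x′ y′
    beyond-≤ x′≤x y′≤y (κ , o , beyond) =
      κ , o , λ b → let x< , y< = beyond b in ≤-<-trans x′≤x x< , ≤-<-trans y′≤y y<

    -- Containment of ατ by an involution is witnessed beyond (x , y) or, after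
    -- reflection, beyond (y , x): allowing both makes the region symmetric.
    Region : ℕ → ℕ → Set
    Region x y = (x < n × y < n) × (Beyond x y ⊎ Beyond y x)

    region-flip : ∀ {x y} → Region x y → Region y x
    region-flip ((x<n , y<n) , b) = (y<n , x<n) , swap b

    region-≤ : DownClosed Region
    region-≤ x′≤x y′≤y ((x<n , y<n) , b) = (≤-<-trans x′≤x x<n , ≤-<-trans y′≤y y<n) ,
      Sum.map (beyond-≤ x′≤x y′≤y) (beyond-≤ y′≤y x′≤x) b

    board : Board n Region
    board = record
      { cell? = λ x y → (x <? n ×-dec y <? n) ×-dec (beyond? x y ⊎-dec beyond? y x)
      ; down  = region-≤
      ; bound = proj₁
      }

    free⇒avoids : Free X Region dots → Avoids π (prefix X ⊕ τ)
    free⇒avoids {X} free (ξ , o) with ι , κ , refl ← splitAt 3 ξ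
      with (ι-mono , ι⇔) , oκ , below ← occurrence-⊕⁻ (prefix X) τ π ι κ o
      = absurd X free ι⇔
      where
      absurd : ∀ X → Free X Region dots →
        (∀ a b → lookup π (lookup ι a) Fin.< lookup π (lookup ι b) ⇔
                   lookup (prefix X) a Fin.< lookup (prefix X) b) → ⊥
      absurd inc free ι⇔ = free (ι-mono {0F} {1F} (s≤s z≤n)) (ι-mono {1F} {2F} (s≤s (s≤s z≤n)))
        (Equivalence.from (ι⇔ 0F 1F) (s≤s z≤n)) (Equivalence.from (ι⇔ 1F 2F) (s≤s (s≤s z≤n)))
        (dots⁺ _) (dots⁺ _) (dots⁺ _)
        ((toℕ<n _ , toℕ<n _) , inj₁ (κ , oκ , below 2F))
      absurd dec free ι⇔ = free (ι-mono {0F} {1F} (s≤s z≤n)) (ι-mono {1F} {2F} (s≤s (s≤s z≤n)))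
        (Equivalence.from (ι⇔ 1F 0F) (s≤s (s≤s z≤n))) (Equivalence.from (ι⇔ 2F 1F) (s≤s z≤n))
        (dots⁺ _) (dots⁺ _) (dots⁺ _)
        -- The corner of a 321 takes its column from the last letter and its row from the first, so
        -- each contributes one of the two bounds.
        ((toℕ<n _ , toℕ<n _) , inj₁ (κ , oκ , λ b → proj₁ (below 2F b) , proj₂ (below 0F b)))

    module _ (involutive : ∀ i → lookup π (lookup π i) ≡ i) where

      -- If τ occurs beyond the mirror image of the corner, the three points are reflected in the
      -- diagonal: a 123 stays a 123, and a 321 stays a 321 with its points in reverse order.
      avoids⇒free : ∀ X → Avoids π (prefix X ⊕ τ) → Free X Region dots
      avoids⇒free inc avoids x₁<x₂ x₂<x₃ y₁<y₂ y₂<y₃ M₁ M₂ M₃ (_ , inj₁ beyond) =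
        contains x₁<x₂ x₂<x₃ y₁<y₂ y₂<y₃ (dots⁻ M₁) (dots⁻ M₂) (dots⁻ M₃) beyond
        where
        contains : ∀ {x₁ x₂ x₃ y₁ y₂ y₃} → x₁ < x₂ → x₂ < x₃ → y₁ < y₂ → y₂ < y₃ →
                   Dot x₁ y₁ → Dot x₂ y₂ → Dot x₃ y₃ → Beyond x₃ y₃ → ⊥
        contains x₁<x₂ x₂<x₃ y₁<y₂ y₂<y₃
          (a , refl , refl) (b , refl , refl) (c , refl , refl) (κ , o , beyond) =
          avoids ((a ∷ b ∷ c ∷ []) ++ κ ,
                  occurrence-⊕⁺ (prefix inc) τ π (a ∷ b ∷ c ∷ []) κ
                    (occurrence-inc π x₁<x₂ x₂<x₃ y₁<y₂ y₂<y₃) o below)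
          where
          below : Below π (a ∷ b ∷ c ∷ []) κ
          below 0F d = <-trans x₁<x₂ (<-trans x₂<x₃ (proj₁ (beyond d))) ,
                       <-trans y₁<y₂ (<-trans y₂<y₃ (proj₂ (beyond d)))
          below 1F d = <-trans x₂<x₃ (proj₁ (beyond d)) , <-trans y₂<y₃ (proj₂ (beyond d))
          below 2F d = beyond d
      avoids⇒free inc avoids x₁<x₂ x₂<x₃ y₁<y₂ y₂<y₃ M₁ M₂ M₃ ((x< , y<) , inj₂ beyond) =
        avoids⇒free inc avoids y₁<y₂ y₂<y₃ x₁<x₂ x₂<x₃
          (dots-flip involutive M₁) (dots-flip involutive M₂) (dots-flip involutive M₃)
          ((y< , x<) , inj₁ beyond)
      avoids⇒free dec avoids x₁<x₂ x₂<x₃ y₂<y₁ y₃<y₂ M₁ M₂ M₃ (_ , inj₁ beyond) =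
        contains x₁<x₂ x₂<x₃ y₂<y₁ y₃<y₂ (dots⁻ M₁) (dots⁻ M₂) (dots⁻ M₃) beyond
        where
        contains : ∀ {x₁ x₂ x₃ y₁ y₂ y₃} → x₁ < x₂ → x₂ < x₃ → y₂ < y₁ → y₃ < y₂ →
                   Dot x₁ y₁ → Dot x₂ y₂ → Dot x₃ y₃ → Beyond x₃ y₁ → ⊥
        contains x₁<x₂ x₂<x₃ y₂<y₁ y₃<y₂
          (a , refl , refl) (b , refl , refl) (c , refl , refl) (κ , o , beyond) =
          avoids ((a ∷ b ∷ c ∷ []) ++ κ ,
                  occurrence-⊕⁺ (prefix dec) τ π (a ∷ b ∷ c ∷ []) κ
                    (occurrence-dec π x₁<x₂ x₂<x₃ y₂<y₁ y₃<y₂) o below)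
          where
          below : Below π (a ∷ b ∷ c ∷ []) κ
          below 0F d = <-trans x₁<x₂ (<-trans x₂<x₃ (proj₁ (beyond d))) , proj₂ (beyond d)
          below 1F d = <-trans x₂<x₃ (proj₁ (beyond d)) , <-trans y₂<y₁ (proj₂ (beyond d))
          below 2F d = proj₁ (beyond d) , <-trans y₃<y₂ (<-trans y₂<y₁ (proj₂ (beyond d)))
      avoids⇒free dec avoids x₁<x₂ x₂<x₃ y₂<y₁ y₃<y₂ M₁ M₂ M₃ ((x< , y<) , inj₂ beyond) =
        avoids⇒free dec avoids y₃<y₂ y₂<y₁ x₂<x₃ x₁<x₂
          (dots-flip involutive M₃) (dots-flip involutive M₂) (dots-flip involutive M₁)
          ((y< , x<) , inj₁ beyond)

-- Invariance of the board under changes made inside it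

occurrence-resp : (π π′ : Vec (Fin n) n) (τ : Vec (Fin m) m) (κ : Vec (Fin n) m) →
  (∀ b → lookup π′ (lookup κ b) ≡ lookup π (lookup κ b)) →
  IsOccurrence π τ κ → IsOccurrence π′ τ κ
occurrence-resp π π′ τ κ agree (mono , iff) = mono , λ a b →
  subst₂ (λ u v → u Fin.< v ⇔ lookup τ a Fin.< lookup τ b) (sym (agree a)) (sym (agree b)) (iff a b)

module _ (π π′ : Vec (Fin n) n) (τ : Vec (Fin m) m)
         (agree : ∀ {x y} → ¬ Region π τ x y → dots π x y ≡ dots π′ x y) where

  private
    value : Fin n → ℕ
    value i = toℕ (lookup π i)

  -- The innermost occurrences of τ lie outside the region, hence survive any
  -- change made inside it.
  Outer : ℕ → ℕ → Set
  Outer x y = ∃ λ κ → IsOccurrence π τ κ × (∀ b → x < toℕ (lookup κ b) × y < value (lookup κ b)) ×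
    (∀ b → ¬ Region π τ (toℕ (lookup κ b)) (value (lookup κ b)))

  outer-≤ : ∀ {x x′ y y′} → x′ ≤ x → y′ ≤ y → Outer x y → Outer x′ y′
  outer-≤ x′≤x y′≤y (κ , o , beyond , outside) =
    κ , o , (λ b → let x< , y< = beyond b in ≤-<-trans x′≤x x< , ≤-<-trans y′≤y y<) , outside

  -- If a point of the occurrence is itself in the region, an occurrence beyond that point, up to
  -- reflection, replaces it. The first coordinate grows each time and stays below `n`; `a` bounds
  -- the steps left.
  outer : ∀ a {x y} → n ≤ a + x → Region π τ x y → Outer x y ⊎ Outer y x
  outer zero n≤x ((x<n , _) , _) = ⊥-elim (<⇒≱ x<n n≤x)
  outer (suc a) {x} {y} n≤ (_ , inj₁ (κ , o , beyond))
    with Fin.any? (λ b → Board.cell? (board π τ) (toℕ (lookup κ b)) (value (lookup κ b)))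
  ... | no outside = inj₁ (κ , o , beyond , λ b r → outside (b , r))
  ... | yes (b , r) = let x< , y< = beyond b in
    Sum.map (outer-≤ (<⇒≤ x<) (<⇒≤ y<)) (outer-≤ (<⇒≤ y<) (<⇒≤ x<))
      (outer a (≤-trans n≤ (≤-trans (≤-reflexive (sym (+-suc a x))) (+-monoʳ-≤ a x<))) r)
  outer (suc a) {x} {y} n≤ (_ , inj₂ (κ , o , beyond))
    with Fin.any? (λ b → Board.cell? (board π τ) (toℕ (lookup κ b)) (value (lookup κ b)))
  ... | no outside = inj₂ (κ , o , beyond , λ b r → outside (b , r))
  ... | yes (b , r) = let y< , x< = beyond b in
    Sum.map (outer-≤ (<⇒≤ x<) (<⇒≤ y<)) (outer-≤ (<⇒≤ y<) (<⇒≤ x<))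
      (outer a (≤-trans n≤ (≤-trans (≤-reflexive (sym (+-suc a x))) (+-monoʳ-≤ a x<)))
        (region-flip π τ r))

  outer⇒beyond : ∀ {x y} → Outer x y → Beyond π′ τ x y
  outer⇒beyond (κ , o , beyond , outside) = κ , occurrence-resp π π′ τ κ same o , λ b →
    subst (λ v → _ × _ < toℕ v) (sym (same b)) (beyond b)
    where
    same : ∀ b → lookup π′ (lookup κ b) ≡ lookup π (lookup κ b)
    same b = dots-lookup π′ (trans (sym (agree (outside b))) (dots⁺ π (lookup κ b)))

  region⁺ : ∀ {x y} → Region π τ x y → Region π′ τ x y
  region⁺ {x} {y} r = proj₁ r , Sum.map outer⇒beyond outer⇒beyond (outer n (m≤m+n n x) r)

  -- Either some point of the occurrence is in the region, which is down-closed, or all its points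
  -- are off the region and hence shared with `π`.
  beyond⁻ : ∀ {x y} → x < n × y < n → Beyond π′ τ x y → Region π τ x y
  beyond⁻ <n (κ , o , beyond)
    with Fin.any? (λ b → Board.cell? (board π τ) (toℕ (lookup κ b)) (toℕ (lookup π′ (lookup κ b))))
  ... | yes (b , r) = let x< , y< = beyond b in region-≤ π τ (<⇒≤ x<) (<⇒≤ y<) r
  ... | no outside = <n , inj₁ (κ , occurrence-resp π′ π τ κ same o , λ b →
    subst (λ v → _ × _ < toℕ v) (sym (same b)) (beyond b))
    where
    same : ∀ b → lookup π (lookup κ b) ≡ lookup π′ (lookup κ b)
    same b = dots-lookup π (trans (agree (λ r → outside (b , r))) (dots⁺ π′ (lookup κ b)))

  region⁻ : ∀ {x y} → Region π′ τ x y → Region π τ x y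
  region⁻ (<n , inj₁ beyond) = beyond⁻ <n beyond
  region⁻ ((x<n , y<n) , inj₂ beyond) = region-flip π τ (beyond⁻ (y<n , x<n) beyond)

-- Involutions from symmetric matrices

involutive⇒isInvolution : (π : Vec (Fin n) n) → (∀ i → lookup π (lookup π i) ≡ i) → IsInvolution π
involutive⇒isInvolution π involutive =
  ( (λ {i} {i′} eq → trans (sym (involutive i)) (trans (cong (lookup π) eq) (involutive i′)))
  , strictlySurjective⇒surjective (λ i → lookup π i , involutive i) ) , involutive

-- Totality and functionality make `P` the graph of a map, and symmetry makes this map its own
-- inverse.
realize : (P : ℕ → ℕ → Bool) → (∀ x y → P x y ≡ P y x) → Functional P →
          (∀ {x y} → P x y ≡ true → x < n × y < n) →
          (∀ (i : Fin n) → ∃ λ y → P (toℕ i) y ≡ true) →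
          ∃ λ π → IsInvolution {n} π × (∀ x y → dots π x y ≡ P x y)
realize {n} P P-sym functional bound total =
  π , involutive⇒isInvolution π involutive , λ x y → ⇔→≡ (mk⇔ to (from x y))
  where
  π : Vec (Fin n) n
  π = tabulate λ i → Fin.fromℕ< (proj₂ (bound (proj₂ (total i))))

  P-π : ∀ i → P (toℕ i) (toℕ (lookup π i)) ≡ true
  P-π i rewrite lookup∘tabulate (λ i → Fin.fromℕ< (proj₂ (bound (proj₂ (total i))))) i
              | toℕ-fromℕ< (proj₂ (bound (proj₂ (total i)))) = proj₂ (total i)

  involutive : ∀ i → lookup π (lookup π i) ≡ i
  involutive i = toℕ-injective (functional (P-π (lookup π i)) (trans (P-sym _ _) (P-π i)))

  to : ∀ {x y} → dots π x y ≡ true → P x y ≡ true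
  to eq with i , refl , refl ← dots⁻ π eq = P-π i

  from : ∀ x y → P x y ≡ true → dots π x y ≡ true
  from x y Pxy with x<n , _ ← bound Pxy =
    dec-true (dot? π x y) (u , u≡x , functional (P-π u) (subst (λ x → P x y ≡ true) (sym u≡x) Pxy))
    where
    u = Fin.fromℕ< x<n
    u≡x = toℕ-fromℕ< x<n

dots-injective : (π π′ : Vec (Fin n) n) → (∀ x y → dots π x y ≡ dots π′ x y) → π ≡ π′
dots-injective π π′ eq = lookup⇒≡ λ i → sym (dots-lookup π′ (trans (sym (eq _ _)) (dots⁺ π i)))
  where
  lookup⇒≡ : (∀ i → lookup π i ≡ lookup π′ i) → π ≡ π′
  lookup⇒≡ h = trans (sym (tabulate∘lookup π)) (trans (tabulate-cong h) (tabulate∘lookup π′))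

-- Comparing cardinalities

lookup-unique : ∀ {A : Set} {xs : List A} → Unique xs →
                ∀ i j → List.lookup xs i ≡ List.lookup xs j → i ≡ j
lookup-unique (_ ∷ _) Fin.zero Fin.zero _ = refl
lookup-unique (x∉ ∷ _) Fin.zero (Fin.suc j) eq = ⊥-elim (All.lookup x∉ (∈-lookup j) eq)
lookup-unique (x∉ ∷ _) (Fin.suc i) Fin.zero eq = ⊥-elim (All.lookup x∉ (∈-lookup i) (sym eq))
lookup-unique (_ ∷ u) (Fin.suc i) (Fin.suc j) eq = cong Fin.suc (lookup-unique u i j eq)

-- Choosing related elements gives a map from positions in `xs` to positions in `ys`. It is
-- injective: a common image forces equal entries, and these have equal positions as `xs` is
-- duplicate-free.
length-≤ : ∀ {A B : Set} {xs : List A} {ys : List B} (R : A → B → Set) → Unique xs →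
           (∀ {x} → x ∈ xs → ∃ λ y → y ∈ ys × R x y) →
           (∀ {x x′ y} → R x y → R x′ y → x ≡ x′) → length xs ≤ length ys
length-≤ {xs = xs} {ys} R unique total injective = injective⇒≤ {f = f} f-injective
  where
  f : Fin (length xs) → Fin (length ys)
  f i = Any.index (proj₁ (proj₂ (total (∈-lookup i))))

  R-f : ∀ i → R (List.lookup xs i) (List.lookup ys (f i))
  R-f i with y , y∈ys , Rxy ← total (∈-lookup i) = subst (R _) (lookup-index y∈ys) Rxy

  f-injective : ∀ {i j} → f i ≡ f j → i ≡ j
  f-injective {i} {j} eq = lookup-unique unique i j
    (injective (R-f i) (subst (λ k → R _ (List.lookup ys k)) (sym eq) (R-f j)))

filter-length-≤ : ∀ {A B : Set} {P : A → Set} {Q : B → Set} (P? : Decidable P) (Q? : Decidable Q)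
  {xs : List A} {ys : List B} (R : A → B → Set) → Unique xs → (∀ y → y ∈ ys) →
  (∀ x → P x → ∃ λ y → Q y × R x y) → (∀ {x x′ y} → R x y → R x′ y → x ≡ x′) →
  length (filter P? xs) ≤ length (filter Q? ys)
filter-length-≤ P? Q? {xs} R unique complete total = length-≤ R (filter⁺ P? unique) λ {x} x∈ →
  let y , Qy , Rxy = total x (proj₂ (∈-filter⁻ P? {xs = xs} x∈))
  in y , ∈-filter⁺ Q? (complete y) Qy , Rxy

-- The correspondence between avoiders

record Match (X Y : Pattern) (τ : Vec (Fin m) m) (π π′ : Vec (Fin n) n) : Set where
  field
    {before after}  : ℕ → ℕ → Shape
    growth  : Growth X (Region π τ) (dots π) before
    growth′ : Growth Y (Region π τ) (dots π′) after
    border  : ∀ {x y} → ¬ Region π τ x y → before x y ≡ after x y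
    outside : ∀ {x y} → ¬ Region π τ x y → after (suc x) (suc y) ≡ ∅
    agree   : ∀ {x y} → ¬ Region π τ x y → dots π x y ≡ dots π′ x y

-- `π′` determines the region, as changes inside it do not move it. It then determines the labels
-- `after` by the forward rules, hence the border labels `before`, and from these the backward rules
-- return the points of `π` in the region; the other points are those of `π′`.
match-injective : ∀ {τ : Vec (Fin m) m} {π₁ π₂ π′ : Vec (Fin n) n} →
                  Match X Y τ π₁ π′ → Match X Y τ π₂ π′ → π₁ ≡ π₂
match-injective {τ = τ} {π₁} {π₂} {π′} E₁ E₂ = dots-injective π₁ π₂ same
  where
  module E₁ = Match E₁
  module E₂ = Match E₂

  ₁⇒₂ : ∀ {x y} → Region π₁ τ x y → Region π₂ τ x y
  ₁⇒₂ = region⁻ π₂ π′ τ E₂.agree ∘ region⁺ π₁ π′ τ E₁.agree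
  ₂⇒₁ : ∀ {x y} → Region π₂ τ x y → Region π₁ τ x y
  ₂⇒₁ = region⁻ π₁ π′ τ E₁.agree ∘ region⁺ π₂ π′ τ E₂.agree

  after≡ : ∀ x y → E₁.after x y ≡ E₂.after x y
  after≡ x y = trans (growth-labels (board π₁ τ) E₁.growth′ E₁.outside x y)
    (sym (growth-labels (board π₁ τ) (growth-resp ₁⇒₂ (λ _ → refl) E₂.growth′)
           (λ ¬r → E₂.outside (¬r ∘ ₂⇒₁)) x y))

  same : ∀ x y → dots π₁ x y ≡ dots π₂ x y
  same x y with Board.cell? (board π₁ τ) x y
  ... | yes r = proj₂ (growth-unique (board π₁ τ) E₁.growth (growth-resp ₁⇒₂ (λ _ → refl) E₂.growth)
    (λ ¬r → trans (E₁.border ¬r) (trans (after≡ _ _) (sym (E₂.border (¬r ∘ ₂⇒₁))))) x y) r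
  ... | no ¬r = trans (E₁.agree ¬r) (sym (E₂.agree (¬r ∘ ₂⇒₁)))

module _ (τ : Vec (Fin m) m) (π : Vec (Fin n) n) (E : Exchange X Y n (Region π τ) (dots π)) where

  open Exchange E

  exchange⇒match : ∃ λ π′ → (IsInvolution π′ × Avoids π′ (prefix Y ⊕ τ)) × Match X Y τ π π′
  exchange⇒match
    with π′ , involution , dots≡ ← realize filling symmetric functional bounded (λ i → total (dots⁺ π i))
    = π′ , (involution , avoids) , record
        { growth = growth ; growth′ = growth″ ; border = border ; outside = outside ; agree = agree′ }
    where
    agree′ : ∀ {x y} → ¬ Region π τ x y → dots π x y ≡ dots π′ x y
    agree′ ¬r = trans (agree ¬r) (sym (dots≡ _ _))

    growth″ : Growth Y (Region π τ) (dots π′) after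
    growth″ = growth-resp id (λ _ → sym (dots≡ _ _)) growth′

    avoids : Avoids π′ (prefix Y ⊕ τ)
    -- The region of `π′` is contained in that of `π`, so the diagram for `Y` restricts to it and
    -- certifies freeness there.
    avoids = free⇒avoids π′ τ (growth-free (region-≤ π′ τ)
      (growth-resp (region⁻ π π′ τ agree′) (λ _ → refl) growth″))

match-exists : ∀ X Y (τ : Vec (Fin m) m) (π : Vec (Fin n) n) →
  (∀ i → lookup π (lookup π i) ≡ i) → Avoids π (prefix X ⊕ τ) →
  ∃ λ π′ → (IsInvolution π′ × Avoids π′ (prefix Y ⊕ τ)) × Match X Y τ π π′
match-exists X Y τ π involutive avoids = exchange⇒match τ π
  (exchange (board π τ) (region-flip π τ) (dots-sym π involutive) (dots-functional π)
    (dots-bound π) (avoids⇒free π τ involutive X avoids))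

𝓘-≤ : ∀ X Y (τ : Vec (Fin m) m) n → 𝓘 n (prefix X ⊕ τ) ≤ 𝓘 n (prefix Y ⊕ τ)
𝓘-≤ X Y τ n = filter-length-≤
  (λ π → isInvolution? π ×-dec avoids? π (prefix X ⊕ τ))
  (λ π → isInvolution? π ×-dec avoids? π (prefix Y ⊕ τ))
  (Match X Y τ) (words-unique n n) words-complete
  (λ π ((_ , involutive) , avoids) → match-exists X Y τ π involutive avoids)
  match-injective

prefixes-exchangeable : PrefixesExchangeable (prefix inc) (prefix dec)
-- Either pattern may play the part of `X`, so there are injections both ways.
prefixes-exchangeable m τ _ n = ≤-antisym (𝓘-≤ inc dec τ n) (𝓘-≤ dec inc τ n)

-- The detour through an equation between the prefixes spares Agda a conversion
-- check that would unfold 𝓘.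
prefixes-exchangeable′ : ∀ {j} {α β : Vec (Fin j) j} →
  _≡_ {A = ∃ λ j → Vec (Fin j) j × Vec (Fin j) j} (3 , prefix inc , prefix dec) (j , α , β) →
  PrefixesExchangeable α β
prefixes-exchangeable′ refl = prefixes-exchangeable

corollary5p4 : PrefixesExchangeable (0F ∷ 1F ∷ 2F ∷ []) (2F ∷ 1F ∷ 0F ∷ [])
corollary5p4 = prefixes-exchangeable′ {_} {0F ∷ 1F ∷ 2F ∷ []} {2F ∷ 1F ∷ 0F ∷ []} refl
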